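{- Let $b\ge 1$, let $L$ be a normalized Latin square of size $b$ over the alphabet $\mathcal A=\{a_1,\dots,a_b\}$, and let $M=\mathcal{E}(L)$ be its encoding matrix. Let $w$ be a word of length $m\ge 1$ over $\mathcal A$ and let $r\ge -1$ be an integer. (1) If $w$ is $r$-regular, then $L(w)$ is $(r+1)$-regular. (2) If $M$ is invertible (as a real matrix) and $L(w)$ is $(r+1)$-regular, then $w$ is $r$-regular. (3) If $M$ is not invertible, then there exist a positive integer $m'$ and a word $w'$ of length $m'$ over $\mathcal A$ such that $L(w')$ is $1$-regular but $w'$ is not $0$-regular.
   Context: Fix an alphabet $\mathcal A=\{a_1,\dots,a_b\}$ of $b$ letters, ordered $a_1<\dots<a_b$; identify $a_q$ with the integer $q$ when convenient. For a word $w=w_1\cdots w_m$ over $\mathcal A$ and an integer $r\ge -1$, $w$ is $r$-regular if for every $k=0,1,\dots,r$ the sum $\sum_{1\le t\le m,\ w_t=x} t^k$ is the same for all letters $x\in\mathcal A$ (a letter not occurring in $w$ contributes the empty sum $0$); every word is $(-1)$-regular. A Latin square of size $b$ over $\mathcal A$ is a $b\times b$ matrix with entries in $\mathcal A$ in which each letter occurs exactly once in each row and each column; it is normalized if its first column is $(a_1,\dots,a_b)^T$, i.e. $L_{q,1}=a_q$. For $k=1,\dots,b$ let $\pi_k$ be the permutation of $\mathcal A$ given by $\pi_k(a_q)=L_{q,k}$ (so $\pi_1=\mathrm{id}$ when $L$ is normalized). For a permutation $\pi$ of $\mathcal A$, $\pi(w_1\cdots w_m)=\pi(w_1)\cdots\pi(w_m)$,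 and $L(w)$ is the concatenation $w\,\pi_2(w)\,\pi_3(w)\cdots\pi_b(w)$, a word of length $bm$. The encoding matrix $M=\mathcal E(L)$ is the $b\times b$ integer matrix defined by $M_{ij}=x$ if and only if $L_{j,x}=a_i$, i.e. $M_{ij}$ is the index of the column in which the letter $a_i$ occurs in row $j$ of $L$. -}

module Defs where

open import Algebra.Bundles.Raw using (RawRing)
import Algebra.Definitions.RawMonoid as RawMonoidDefs
open import Data.Bool using (if_then_else_)
open import Data.Fin as Fin using (Fin; toℕ)
open import Data.Integer as ℤ using (ℤ; +_)
open import Data.Nat as ℕ using (ℕ; suc)
import Data.Nat.Properties as ℕ
open import Data.Product using (∃; ∃!; _×_; _,_; proj₁; proj₂)
open import Data.Rational as ℚ using (ℚ; 0ℚ; 1ℚ; ½)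
import Data.Rational.Properties as ℚ
open import Data.Rational.Solver using (module +-*-Solver)
open import Data.Vec.Functional using (Vector; concat)
open import Function using (_⇔_; mk⇔)
open import Level using (0ℓ; _⊔_)
open import Relation.Binary.PropositionalEquality
  using (_≡_; refl; sym; trans; cong; cong₂; subst)
open import Relation.Nullary using (does)

-- The letter a_q is the element of Fin b whose
-- toℕ is q - 1; likewise for positions and column indices.

Word : ℕ → ℕ → Set
Word b m = Vector (Fin b) m

powerSum : ∀ {b m} → ℕ → Word b m → Fin b → ℕ
powerSum k w x = sum λ t → if does (w t Fin.≟ x) then suc (toℕ t) ℕ.^ k else 0
  where open RawMonoidDefs ℕ.+-0-rawMonoid using (sum)

Regular : ∀ {b m} → ℤ → Word b m → Set
Regular r w = ∀ (k : ℕ) → + k ℤ.≤ r → ∀ x y → powerSum k w x ≡ powerSum k w y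

record LatinSquare (b : ℕ) : Set where
  field
    entry : Fin b → Fin b → Fin b   -- row index first
    row   : ∀ j x → ∃! _≡_ λ k → entry j k ≡ x
    col   : ∀ k x → ∃! _≡_ λ j → entry j k ≡ x

open LatinSquare public

-- The hypothesis toℕ k ≡ 0 selects the first column.
Normalized : ∀ {b} → LatinSquare b → Set
Normalized L = ∀ q k → toℕ k ≡ 0 → entry L q k ≡ q

π : ∀ {b} → LatinSquare b → Fin b → Fin b → Fin b
π L k q = entry L q k

-- The word L(w).  Its first block is π₁(w), which is w itself because
-- the word is only considered for normalized L.
apply : ∀ {b m} → LatinSquare b → Word b m → Word b (b ℕ.* m)
apply L w = concat λ k t → π L k (w t)

Matrix : ∀ {a} → Set a → ℕ → Set a
Matrix A b = Fin b → Fin b → A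

columnOf : ∀ {b} → LatinSquare b → Fin b → Fin b → Fin b
columnOf L j x = proj₁ (row L j x)

-- Entries are column indices counted from 1.
𝓔 : ∀ {b} → LatinSquare b → Matrix ℤ b
𝓔 L i j = + suc (toℕ (columnOf L j i))

𝓔-spec : ∀ {b} (L : LatinSquare b) i j x →
         𝓔 L i j ≡ + suc (toℕ x) ⇔ entry L j x ≡ i
𝓔-spec L i j x = mk⇔
  (λ e → subst (λ k → entry L j k ≡ i)
           (Fin.toℕ-injective (ℕ.suc-injective (ℤ.+-injective e)))
           (proj₁ (proj₂ (row L j i))))
  (λ e → cong (λ k → + suc (toℕ k)) (proj₂ (proj₂ (row L j i)) e))
  where
  import Data.Fin.Properties as Fin
  import Data.Integer.Properties as ℤ

-- Reals as Cauchy sequences of rationals, equal when their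
-- difference tends to 0.  All operations are termwise.

record ℝ : Set where
  constructor mkℝ
  field
    seq    : ℕ → ℚ
    cauchy : ∀ ε → 0ℚ ℚ.< ε → ∃ λ N → ∀ m n → N ℕ.≤ m → N ℕ.≤ n →
             ℚ.∣ seq m ℚ.- seq n ∣ ℚ.< ε

open ℝ public

infix 4 _≈ᴿ_

_≈ᴿ_ : ℝ → ℝ → Set
x ≈ᴿ y = ∀ ε → 0ℚ ℚ.< ε → ∃ λ N → ∀ n → N ℕ.≤ n →
         ℚ.∣ seq x n ℚ.- seq y n ∣ ℚ.< ε

fromℚ : ℚ → ℝ
fromℚ p = mkℝ (λ _ → p) λ ε ε>0 → 0 , λ _ _ _ _ →
  subst (λ z → ℚ.∣ z ∣ ℚ.< ε) (sym (ℚ.+-inverseʳ p)) ε>0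

fromℤ : ℤ → ℝ
fromℤ i = fromℚ (i ℚ./ 1)

private
  open +-*-Solver using (solve; _:+_; _:*_; :-_; _:-_; _:=_)

  half>0 : ∀ {ε} → 0ℚ ℚ.< ε → 0ℚ ℚ.< ½ ℚ.* ε
  half>0 {ε} ε>0 = subst (ℚ._< ½ ℚ.* ε) (ℚ.*-zeroʳ ½) (ℚ.*-monoʳ-<-pos ½ ε>0)

  halves : ∀ ε → ½ ℚ.* ε ℚ.+ ½ ℚ.* ε ≡ ε
  halves ε = trans (sym (ℚ.*-distribʳ-+ ε ½ ½)) (ℚ.*-identityˡ ε)

infixl 6 _+ᴿ_
infixl 7 _*ᴿ_
infix  8 -ᴿ_

_+ᴿ_ : ℝ → ℝ → ℝ
x +ᴿ y = mkℝ (λ n → seq x n ℚ.+ seq y n) λ ε ε>0 →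
  let (M , p) = cauchy x (½ ℚ.* ε) (half>0 ε>0)
      (N , q) = cauchy y (½ ℚ.* ε) (half>0 ε>0)
  in M ℕ.⊔ N , λ m n h k → begin-strict
    ℚ.∣ (seq x m ℚ.+ seq y m) ℚ.- (seq x n ℚ.+ seq y n) ∣
      ≡⟨ cong ℚ.∣_∣ (rearrange (seq x m) (seq y m) (seq x n) (seq y n)) ⟩
    ℚ.∣ (seq x m ℚ.- seq x n) ℚ.+ (seq y m ℚ.- seq y n) ∣
      ≤⟨ ℚ.∣p+q∣≤∣p∣+∣q∣ (seq x m ℚ.- seq x n) (seq y m ℚ.- seq y n) ⟩
    ℚ.∣ seq x m ℚ.- seq x n ∣ ℚ.+ ℚ.∣ seq y m ℚ.- seq y n ∣
      <⟨ ℚ.+-mono-< (p m n (ℕ.m⊔n≤o⇒m≤o M N h) (ℕ.m⊔n≤o⇒m≤o M N k))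
                    (q m n (ℕ.m⊔n≤o⇒n≤o M N h) (ℕ.m⊔n≤o⇒n≤o M N k)) ⟩
    ½ ℚ.* ε ℚ.+ ½ ℚ.* ε
      ≡⟨ halves ε ⟩
    ε ∎
  where
  open ℚ.≤-Reasoning
  rearrange : ∀ a b c d →
              (a ℚ.+ b) ℚ.- (c ℚ.+ d) ≡ (a ℚ.- c) ℚ.+ (b ℚ.- d)
  rearrange = solve 4 (λ a b c d →
    (a :+ b) :- (c :+ d) := (a :- c) :+ (b :- d)) refl

-ᴿ_ : ℝ → ℝ
-ᴿ x = mkℝ (λ n → ℚ.- seq x n) λ ε ε>0 →
  let (N , p) = cauchy x ε ε>0
  in N , λ m n h k → subst (ℚ._< ε)
       (trans (sym (ℚ.∣-p∣≡∣p∣ (seq x m ℚ.- seq x n)))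
              (cong ℚ.∣_∣ (rearrange (seq x m) (seq x n))))
       (p m n h k)
  where
  rearrange : ∀ a b → ℚ.- (a ℚ.- b) ≡ (ℚ.- a) ℚ.- (ℚ.- b)
  rearrange = solve 2 (λ a b → :- (a :- b) := (:- a) :- (:- b)) refl

private
  eventuallyBounded : ∀ x → ∃ λ B → 0ℚ ℚ.< B ×
    ∃ λ N → ∀ n → N ℕ.≤ n → ℚ.∣ seq x n ∣ ℚ.≤ B
  eventuallyBounded x =
    let (N , p) = cauchy x 1ℚ (ℚ.positive⁻¹ 1ℚ)
    in 1ℚ ℚ.+ ℚ.∣ seq x N ∣
     , ℚ.+-mono-<-≤ (ℚ.positive⁻¹ 1ℚ) (ℚ.0≤∣p∣ (seq x N))
     , N , λ n h → begin
         ℚ.∣ seq x n ∣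
           ≡⟨ cong ℚ.∣_∣ (rearrange (seq x n) (seq x N)) ⟩
         ℚ.∣ (seq x n ℚ.- seq x N) ℚ.+ seq x N ∣
           ≤⟨ ℚ.∣p+q∣≤∣p∣+∣q∣ (seq x n ℚ.- seq x N) (seq x N) ⟩
         ℚ.∣ seq x n ℚ.- seq x N ∣ ℚ.+ ℚ.∣ seq x N ∣
           ≤⟨ ℚ.+-monoˡ-≤ ℚ.∣ seq x N ∣ (ℚ.<⇒≤ (p n N h ℕ.≤-refl)) ⟩
         1ℚ ℚ.+ ℚ.∣ seq x N ∣ ∎
    where
    open ℚ.≤-Reasoning
    rearrange : ∀ a b → a ≡ (a ℚ.- b) ℚ.+ b
    rearrange = solve 2 (λ a b → a := (a :- b) :+ b) refl

  shrink : ∀ B ε → 0ℚ ℚ.< B → 0ℚ ℚ.< ε →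
           ∃ λ δ → 0ℚ ℚ.< δ × B ℚ.* δ ≡ ε
  shrink B ε B>0 ε>0 = B⁻¹ ℚ.* ε
    , subst (ℚ._< B⁻¹ ℚ.* ε) (ℚ.*-zeroʳ B⁻¹) (ℚ.*-monoʳ-<-pos B⁻¹ ε>0)
    , trans (sym (ℚ.*-assoc B B⁻¹ ε))
            (trans (cong (ℚ._* ε) (ℚ.*-inverseʳ B)) (ℚ.*-identityˡ ε))
    where
    instance
      B⁺ : ℚ.Positive B
      B⁺ = ℚ.positive B>0
      B≢0 : ℚ.NonZero B
      B≢0 = ℚ.pos⇒nonZero B
    B⁻¹ : ℚ
    B⁻¹ = ℚ.1/ B
    instance
      B⁻¹⁺ : ℚ.Positive B⁻¹
      B⁻¹⁺ = ℚ.1/pos⇒pos B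

  bounded-* : ∀ B δ p q → 0ℚ ℚ.< B → ℚ.∣ p ∣ ℚ.≤ B → ℚ.∣ q ∣ ℚ.< δ →
              ℚ.∣ p ℚ.* q ∣ ℚ.< B ℚ.* δ
  bounded-* B δ p q B>0 p≤B q<δ = begin-strict
    ℚ.∣ p ℚ.* q ∣          ≡⟨ ℚ.∣p*q∣≡∣p∣*∣q∣ p q ⟩
    ℚ.∣ p ∣ ℚ.* ℚ.∣ q ∣    ≤⟨ ℚ.*-monoʳ-≤-nonNeg ℚ.∣ q ∣ p≤B ⟩
    B ℚ.* ℚ.∣ q ∣          <⟨ ℚ.*-monoʳ-<-pos B q<δ ⟩
    B ℚ.* δ                ∎
    where
    open ℚ.≤-Reasoning
    instance
      B⁺ : ℚ.Positive B
      B⁺ = ℚ.positive B>0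
      ∣q∣⁺ : ℚ.NonNegative ℚ.∣ q ∣
      ∣q∣⁺ = ℚ.nonNegative (ℚ.0≤∣p∣ q)

_*ᴿ_ : ℝ → ℝ → ℝ
x *ᴿ y = mkℝ (λ n → seq x n ℚ.* seq y n) λ ε ε>0 →
  let (A , A>0 , M₁ , a)  = eventuallyBounded x
      (B , B>0 , N₁ , b)  = eventuallyBounded y
      (δ , δ>0 , Aδ≡½ε)   = shrink A (½ ℚ.* ε) A>0 (half>0 ε>0)
      (η , η>0 , Bη≡½ε)   = shrink B (½ ℚ.* ε) B>0 (half>0 ε>0)
      (M₂ , q)            = cauchy y δ δ>0
      (N₂ , p)            = cauchy x η η>0
      M = M₁ ℕ.⊔ M₂
      N = N₁ ℕ.⊔ N₂
  in M ℕ.⊔ N , λ m n h k →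
    let Mm = ℕ.m⊔n≤o⇒m≤o M N h
        Mn = ℕ.m⊔n≤o⇒m≤o M N k
        Nm = ℕ.m⊔n≤o⇒n≤o M N h
        Nn = ℕ.m⊔n≤o⇒n≤o M N k
    in begin-strict
    ℚ.∣ seq x m ℚ.* seq y m ℚ.- seq x n ℚ.* seq y n ∣
      ≡⟨ cong ℚ.∣_∣ (rearrange (seq x m) (seq y m) (seq x n) (seq y n)) ⟩
    ℚ.∣ seq x m ℚ.* (seq y m ℚ.- seq y n) ℚ.+ seq y n ℚ.* (seq x m ℚ.- seq x n) ∣
      ≤⟨ ℚ.∣p+q∣≤∣p∣+∣q∣ (seq x m ℚ.* (seq y m ℚ.- seq y n))
                         (seq y n ℚ.* (seq x m ℚ.- seq x n)) ⟩
    ℚ.∣ seq x m ℚ.* (seq y m ℚ.- seq y n) ∣ ℚ.+ ℚ.∣ seq y n ℚ.* (seq x m ℚ.- seq x n) ∣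
      <⟨ ℚ.+-mono-<
           (bounded-* A δ (seq x m) (seq y m ℚ.- seq y n) A>0
             (a m (ℕ.m⊔n≤o⇒m≤o M₁ M₂ Mm))
             (q m n (ℕ.m⊔n≤o⇒n≤o M₁ M₂ Mm) (ℕ.m⊔n≤o⇒n≤o M₁ M₂ Mn)))
           (bounded-* B η (seq y n) (seq x m ℚ.- seq x n) B>0
             (b n (ℕ.m⊔n≤o⇒m≤o N₁ N₂ Nn))
             (p m n (ℕ.m⊔n≤o⇒n≤o N₁ N₂ Nm) (ℕ.m⊔n≤o⇒n≤o N₁ N₂ Nn))) ⟩
    A ℚ.* δ ℚ.+ B ℚ.* η
      ≡⟨ cong₂ ℚ._+_ Aδ≡½ε Bη≡½ε ⟩
    ½ ℚ.* ε ℚ.+ ½ ℚ.* ε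
      ≡⟨ halves ε ⟩
    ε ∎
  where
  open ℚ.≤-Reasoning
  rearrange : ∀ a b c d →
    a ℚ.* b ℚ.- c ℚ.* d ≡ a ℚ.* (b ℚ.- d) ℚ.+ d ℚ.* (a ℚ.- c)
  rearrange = solve 4 (λ a b c d →
    a :* b :- c :* d := a :* (b :- d) :+ d :* (a :- c)) refl

ℝ-rawRing : RawRing 0ℓ 0ℓ
ℝ-rawRing = record
  { Carrier = ℝ
  ; _≈_     = _≈ᴿ_
  ; _+_     = _+ᴿ_
  ; _*_     = _*ᴿ_
  ; -_      = -ᴿ_
  ; 0#      = fromℚ 0ℚ
  ; 1#      = fromℚ 1ℚ
  }

module _ {c ℓ} (R : RawRing c ℓ) where
  open RawRing R
  open RawMonoidDefs +-rawMonoid using (sum)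

  matMul : ∀ {b} → Matrix Carrier b → Matrix Carrier b → Matrix Carrier b
  matMul A B i j = sum λ k → A i k * B k j

  idMatrix : ∀ {b} → Matrix Carrier b
  idMatrix i j = if does (i Fin.≟ j) then 1# else 0#

  Invertible : ∀ {b} → Matrix Carrier b → Set (c ⊔ ℓ)
  Invertible A = ∃ λ B →
    (∀ i j → matMul A B i j ≈ idMatrix i j) ×
    (∀ i j → matMul B A i j ≈ idMatrix i j)

RealInvertible : ∀ {b} → Matrix ℤ b → Set
RealInvertible M = Invertible ℝ-rawRing λ i j → fromℤ (M i j)

{-# OPTIONS --safe #-}
module Submission where

-- Let c(j,x) be the column, counted from 0, of the letter x in row j of L, and
-- S_u(j) the u-th power sum of w at j.  The letter x occupies the positions
-- m c(w_t,x) + t of L(w), so expanding the n-th power sum of L(w) at x gives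
-- Σ_i C(n,i) m^i Σ_j c(j,x)^i S_(n-i)(j).  The term i = 0 does not depend on x,
-- and a term with constant S_(n-i) does not either, c(-,x) being a permutation.
-- This gives (1).  When S_0, ..., S_(n-2) are constant, the sum is independent
-- of x exactly when Σ_j c(j,x) S_(n-1)(j) is, i.e. when M S_(n-1) is constant.
-- As M has constant row sums, for injective M this forces S_(n-1) to be
-- constant, which gives (2).  For singular M a nonzero integer kernel vector is
-- not constant; shifted to be nonnegative, it provides the letter counts in (3).

open import Defs
open import Data.Integer using (ℤ; -1ℤ; 1ℤ; 0ℤ) renaming (_+_ to _+ℤ_; _≤_ to _≤ℤ_)
open import Data.Nat using (ℕ; _≤_)
open import Data.Product using (_×_; ∃; Σ)
open import Relation.Nullary using (¬_)

open import Algebra.Bundles using (Monoid; CommutativeRing)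
open import Algebra.Bundles.Raw using (RawRing)
import Algebra.Definitions.RawMonoid as RawMonoidDefs
import Algebra.Properties.AbelianGroup as AbelianGroupProperties
import Algebra.Properties.Monoid.Sum as MonoidSum
import Algebra.Properties.Semiring.Sum as SemiringSum
open import Data.Bool using (if_then_else_)
open import Data.Fin as Fin using (Fin; toℕ; combine; punchIn)
import Data.Fin.Permutation as Perm
import Data.Fin.Properties as Fin
open import Data.Integer as ℤ using (+_; -[1+_])
import Data.Integer.Properties as ℤ
import Data.Integer.Tactic.RingSolver as ℤ-Ring
open import Data.List as List using (List; []; _∷_; _++_)
open import Data.Nat as ℕ using (zero; suc; _<_)
import Data.Nat.Properties as ℕ
import Data.Nat.Tactic.RingSolver as ℕ-Ring
open import Data.Product using (_,_; proj₁; proj₂; uncurry)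
open import Data.Rational as ℚ using (ℚ; 0ℚ; 1ℚ)
import Data.Rational.Properties as ℚ
open import Data.Rational.Solver using (module +-*-Solver)
import Data.Rational.Unnormalised as ℚᵘ
import Data.Rational.Unnormalised.Properties as ℚᵘ
open import Data.Sum using (_⊎_; inj₁; inj₂; fromInj₁)
open import Data.Vec.Functional as Vector using (Vector; insertAt)
open import Data.Vec.Functional.Properties using (insertAt-lookup; insertAt-punchIn)
open import Function using (_∘_)
open import Level using (0ℓ)
open import Relation.Binary.PropositionalEquality
  using (_≡_; _≢_; refl; sym; trans; cong; cong₂; subst; module ≡-Reasoning)
open import Relation.Nullary using (Dec; does; yes; no; ¬?; contradiction)
open import Relation.Nullary.Decidable using (dec-true; dec-false; decidable-stable)

module ℤ-Group = AbelianGroupProperties ℤ.+-0-abelianGroup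

-- Finite sums in a monoid

module FiniteSum {c ℓ} (M : Monoid c ℓ) where
  open Monoid M
    renaming ( _∙_ to _+_; ε to 0#; ∙-cong to +-cong; ∙-congˡ to +-congˡ; assoc to +-assoc
             ; identityˡ to +-identityˡ; identityʳ to +-identityʳ )
  open MonoidSum M using (sum)

  sum-zero : ∀ {n} (f : Vector Carrier n) → (∀ i → f i ≈ 0#) → sum f ≈ 0#
  sum-zero {zero}  f f≈0 = Monoid.refl M
  sum-zero {suc n} f f≈0 = Monoid.trans M
    (+-cong (f≈0 Fin.zero) (sum-zero (f ∘ Fin.suc) (f≈0 ∘ Fin.suc)))
    (+-identityˡ 0#)

  sum-supported : ∀ {n} (f : Vector Carrier n) i → (∀ j → j ≢ i → f j ≈ 0#) → sum f ≈ f i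
  sum-supported f Fin.zero f≈0 = Monoid.trans M
    (+-congˡ (sum-zero (f ∘ Fin.suc) (λ j → f≈0 (Fin.suc j) λ ())))
    (+-identityʳ _)
  sum-supported f (Fin.suc i) f≈0 = Monoid.trans M
    (+-cong (f≈0 Fin.zero λ ())
            (sum-supported (f ∘ Fin.suc) i (λ j j≢i → f≈0 (Fin.suc j) (j≢i ∘ Fin.suc-injective))))
    (+-identityˡ _)

  sum-indicator : ∀ {n p} {P : Fin n → Set p} (P? : ∀ i → Dec (P i)) (f : Vector Carrier n) i →
                  P i → (∀ j → P j → j ≡ i) →
                  sum (λ j → if does (P? j) then f j else 0#) ≈ f i
  sum-indicator P? f i Pi unique = Monoid.trans M
    (sum-supported _ i λ j j≢i →
      reflexive (cong (if_then f j else 0#) (dec-false (P? j) (j≢i ∘ unique j))))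
    (reflexive (cong (if_then f i else 0#) (dec-true (P? i) Pi)))

  sum-split : ∀ m {n} (f : Vector Carrier (m ℕ.+ n)) →
              sum f ≈ sum (λ i → f (i Fin.↑ˡ n)) + sum (λ j → f (m Fin.↑ʳ j))
  sum-split zero    f = Monoid.sym M (+-identityˡ _)
  sum-split (suc m) f = Monoid.trans M
    (+-congˡ (sum-split m (f ∘ Fin.suc)))
    (Monoid.sym M (+-assoc _ _ _))

  -- Splits the positions of a concatenation into block number and place within the block.
  sum-combine : ∀ n {m} (f : Vector Carrier (n ℕ.* m)) →
                sum f ≈ sum (λ (i : Fin n) → sum (λ (j : Fin m) → f (combine i j)))
  sum-combine zero        f = Monoid.refl M
  sum-combine (suc n) {m} f = Monoid.trans M
    (sum-split m f)
    (+-congˡ (sum-combine n (λ j → f (m Fin.↑ʳ j))))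

open FiniteSum ℕ.+-0-monoid
open SemiringSum ℕ.+-*-semiring
  using (sum; sum-cong-≗; ∑-distrib-+; ∑-comm; ∑-permute; *-distribˡ-sum; *-distribʳ-sum)

-- Power sums of L(w)

Balanced : ∀ {b m} → ℕ → Word b m → Set
Balanced k w = ∀ x y → powerSum k w x ≡ powerSum k w y

-- Each position is spread over all letters by the indicator of `w t ≡ j`; exchanging the two sums
-- collects the positions of each letter.
sum-by-letter : ∀ {b m} (w : Word b m) (g : Fin b → ℕ) (h : Fin m → ℕ) →
                sum (λ t → g (w t) ℕ.* h t) ≡
                sum (λ j → g j ℕ.* sum (λ t → if does (w t Fin.≟ j) then h t else 0))
sum-by-letter {b} {m} w g h = begin
  sum (λ t → g (w t) ℕ.* h t)
    ≡⟨ sum-cong-≗ (λ t → sum-indicator (w t Fin.≟_) (λ j → g j ℕ.* h t) (w t) refl (λ _ → sym)) ⟨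
  sum (λ t → sum (λ j → if does (w t Fin.≟ j) then g j ℕ.* h t else 0))
    ≡⟨ ∑-comm {m} {b} (λ t j → if does (w t Fin.≟ j) then g j ℕ.* h t else 0) ⟩
  sum (λ j → sum (λ t → if does (w t Fin.≟ j) then g j ℕ.* h t else 0))
    ≡⟨ sum-cong-≗ (λ j → sum-cong-≗ (λ t → pull (w t Fin.≟ j) (g j) (h t))) ⟩
  sum (λ j → sum (λ t → g j ℕ.* (if does (w t Fin.≟ j) then h t else 0)))
    ≡⟨ sum-cong-≗ (λ j → *-distribˡ-sum {m} (g j) (λ t → if does (w t Fin.≟ j) then h t else 0)) ⟨
  sum (λ j → g j ℕ.* sum (λ t → if does (w t Fin.≟ j) then h t else 0)) ∎
  where
  open ≡-Reasoning
  pull : ∀ {p} {P : Set p} (P? : Dec P) x y →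
         (if does P? then x ℕ.* y else 0) ≡ x ℕ.* (if does P? then y else 0)
  pull (yes _) x y = refl
  pull (no _)  x y = sym (ℕ.*-zeroʳ x)

-- The mixed form lets moment-step replace the binomial theorem: induction on q
-- reduces moment w a 0 n 0 to the moments with q = 0.
moment : ∀ {b m} → Word b m → (Fin b → ℕ) → ℕ → ℕ → ℕ → ℕ
moment w a p q u =
  sum λ t → a (w t) ℕ.^ p ℕ.* (a (w t) ℕ.+ suc (toℕ t)) ℕ.^ q ℕ.* suc (toℕ t) ℕ.^ u

-- One factor `a + t` is expanded: its summand `a` raises `p`, its summand `t` raises `u`.
moment-step : ∀ {b m} (w : Word b m) a p q u →
              moment w a p (suc q) u ≡ moment w a (suc p) q u ℕ.+ moment w a p q (suc u)
moment-step {m = m} w a p q u = trans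
  (sum-cong-≗ λ t → expand (a (w t)) (suc (toℕ t)) (a (w t) ℕ.^ p) _ (suc (toℕ t) ℕ.^ u))
  (∑-distrib-+ {m} (λ t → a (w t) ℕ.^ suc p ℕ.* (a (w t) ℕ.+ suc (toℕ t)) ℕ.^ q ℕ.* suc (toℕ t) ℕ.^ u)
                   (λ t → a (w t) ℕ.^ p ℕ.* (a (w t) ℕ.+ suc (toℕ t)) ℕ.^ q ℕ.* suc (toℕ t) ℕ.^ suc u))
  where
  expand : ∀ a t P Q U → P ℕ.* ((a ℕ.+ t) ℕ.* Q) ℕ.* U ≡ a ℕ.* P ℕ.* Q ℕ.* U ℕ.+ P ℕ.* Q ℕ.* (t ℕ.* U)
  expand = ℕ-Ring.solve-∀

moment-powerSum : ∀ {b m} (w : Word b m) a p u →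
                  moment w a p 0 u ≡ sum (λ j → a j ℕ.^ p ℕ.* powerSum u w j)
moment-powerSum w a p u = trans
  (sum-cong-≗ λ t → cong (ℕ._* suc (toℕ t) ℕ.^ u) (ℕ.*-identityʳ (a (w t) ℕ.^ p)))
  (sum-by-letter w (λ j → a j ℕ.^ p) (λ t → suc (toℕ t) ℕ.^ u))

module _ {b m} (L : LatinSquare b) (w : Word b m) where

  -- An occurrence of the letter `j` at position t of `w` produces the letter `x` at position
  -- `offset x j` + t of `apply L w`.
  offset : Fin b → Fin b → ℕ
  offset x j = m ℕ.* toℕ (columnOf L j x)

  -- For each place t the letter `x` stands there in exactly one block, the one numbered by the
  -- column of `x` in row `w t`. With the sum over blocks inside, `sum-indicator` picks out that
  -- block.
  powerSum-apply : ∀ n x → powerSum n (apply L w) x ≡ moment w (offset x) 0 n 0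
  powerSum-apply n x = begin
    powerSum n (apply L w) x
      ≡⟨ sum-combine b {m} (λ i → if does (apply L w i Fin.≟ x) then suc (toℕ i) ℕ.^ n else 0) ⟩
    sum (λ (k : Fin b) → sum (λ (t : Fin m) → if does (apply L w (combine k t) Fin.≟ x)
                          then suc (toℕ (combine k t)) ℕ.^ n else 0))
      ≡⟨ sum-cong-≗ (λ k → sum-cong-≗ (λ t →
           cong₂ (λ y p → if does (y Fin.≟ x) then p ℕ.^ n else 0) (letter k t) (position k t))) ⟩
    sum (λ k → sum (λ t → if does (entry L (w t) k Fin.≟ x)
                          then (m ℕ.* toℕ k ℕ.+ suc (toℕ t)) ℕ.^ n else 0))
      ≡⟨ ∑-comm {b} {m} (λ k t → if does (entry L (w t) k Fin.≟ x)
                                 then (m ℕ.* toℕ k ℕ.+ suc (toℕ t)) ℕ.^ n else 0) ⟩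
    sum (λ t → sum (λ k → if does (entry L (w t) k Fin.≟ x)
                          then (m ℕ.* toℕ k ℕ.+ suc (toℕ t)) ℕ.^ n else 0))
      ≡⟨ sum-cong-≗ (λ t → sum-indicator (λ k → entry L (w t) k Fin.≟ x)
           (λ k → (m ℕ.* toℕ k ℕ.+ suc (toℕ t)) ℕ.^ n) (columnOf L (w t) x)
           (proj₁ (proj₂ (row L (w t) x))) (λ _ → sym ∘ proj₂ (proj₂ (row L (w t) x)))) ⟩
    sum (λ t → (offset x (w t) ℕ.+ suc (toℕ t)) ℕ.^ n)
      ≡⟨ sum-cong-≗ (λ t → units ((offset x (w t) ℕ.+ suc (toℕ t)) ℕ.^ n)) ⟨
    moment w (offset x) 0 n 0 ∎
    where
    open ≡-Reasoning
    letter : ∀ k t → apply L w (combine k t) ≡ entry L (w t) k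
    letter k t = cong (uncurry λ k t → entry L (w t) k) (Fin.remQuot-combine k t)
    position : ∀ (k : Fin b) (t : Fin m) → suc (toℕ (combine k t)) ≡ m ℕ.* toℕ k ℕ.+ suc (toℕ t)
    position k t = trans (cong suc (Fin.toℕ-combine k t)) (sym (ℕ.+-suc _ _))
    units : ∀ y → 1 ℕ.* y ℕ.* 1 ≡ y
    units = ℕ-Ring.solve-∀

module _ {b} (L : LatinSquare b) where

  -- For fixed `x`, sending a row to the column of `x` is a permutation; its inverse comes from
  -- `col`.
  sum-columnOf : ∀ x (f : Fin b → ℕ) → sum (λ j → f (columnOf L j x)) ≡ sum f
  sum-columnOf x f = sym (∑-permute f (Perm.permutation (λ j → columnOf L j x) (λ k → proj₁ (col L k x))
    (λ k → proj₂ (proj₂ (row L _ x)) (proj₁ (proj₂ (col L k x))))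
    (λ j → proj₂ (proj₂ (col L _ x)) (proj₁ (proj₂ (row L j x))))))

-- Comparison of two families of offsets

module Comparison {b m} (w : Word b m) (x₀ : Fin b) (a a′ : Fin b → ℕ)
  (samePowers : ∀ p → sum (λ j → a j ℕ.^ p) ≡ sum (λ j → a′ j ℕ.^ p)) where

  open ≡-Reasoning

  -- A constant power sum factors out of the sum over letters and leaves a power sum of the offsets,
  -- to which `samePowers` applies.
  moment-balanced : ∀ p u → Balanced u w → moment w a p 0 u ≡ moment w a′ p 0 u
  moment-balanced p u bal = begin
    moment w a p 0 u                                 ≡⟨ factor a ⟩
    sum (λ j → a j ℕ.^ p) ℕ.* powerSum u w x₀        ≡⟨ cong (ℕ._* powerSum u w x₀) (samePowers p) ⟩
    sum (λ j → a′ j ℕ.^ p) ℕ.* powerSum u w x₀       ≡⟨ factor a′ ⟨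
    moment w a′ p 0 u                                ∎
    where
    factor : ∀ a → moment w a p 0 u ≡ sum (λ j → a j ℕ.^ p) ℕ.* powerSum u w x₀
    factor a = begin
      moment w a p 0 u                               ≡⟨ moment-powerSum w a p u ⟩
      sum (λ j → a j ℕ.^ p ℕ.* powerSum u w j)       ≡⟨ sum-cong-≗ (λ j → cong (a j ℕ.^ p ℕ.*_) (bal j x₀)) ⟩
      sum (λ j → a j ℕ.^ p ℕ.* powerSum u w x₀)      ≡⟨ *-distribʳ-sum (powerSum u w x₀) (λ j → a j ℕ.^ p) ⟨
      sum (λ j → a j ℕ.^ p) ℕ.* powerSum u w x₀      ∎

  -- Expansion by `moment-step` lowers `q` without raising `q + u`, so at `q = 0` only balanced
  -- exponents remain.
  moment-high : ∀ {N} → (∀ k → k < N → Balanced k w) →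
                ∀ p q u → q ℕ.+ u < N → moment w a p q u ≡ moment w a′ p q u
  moment-high     bal p zero    u u<N = moment-balanced p u (bal u u<N)
  moment-high {N} bal p (suc q) u h   = begin
    moment w a p (suc q) u
      ≡⟨ moment-step w a p q u ⟩
    moment w a (suc p) q u ℕ.+ moment w a p q (suc u)
      ≡⟨ cong₂ ℕ._+_ (moment-high bal (suc p) q u (ℕ.<⇒≤ h))
                     (moment-high bal p q (suc u) (subst (_< N) (sym (ℕ.+-suc q u)) h)) ⟩
    moment w a′ (suc p) q u ℕ.+ moment w a′ p q (suc u)
      ≡⟨ moment-step w a′ p q u ⟨
    moment w a′ p (suc q) u ∎

  -- Exponent `n`, about which nothing is assumed, is reached only by the term without any factor of
  -- the offsets. That term is the same for `a` and `a′`, hence `refl`.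
  moment-top : ∀ {n} → (∀ k → k < n → Balanced k w) →
               ∀ q u → q ℕ.+ u ≡ n → moment w a 0 q u ≡ moment w a′ 0 q u
  moment-top bal zero    u _    = refl
  moment-top bal (suc q) u refl = begin
    moment w a 0 (suc q) u
      ≡⟨ moment-step w a 0 q u ⟩
    moment w a 1 q u ℕ.+ moment w a 0 q (suc u)
      ≡⟨ cong₂ ℕ._+_ (moment-high bal 1 q u ℕ.≤-refl)
                     (moment-top bal q (suc u) (ℕ.+-suc q u)) ⟩
    moment w a′ 1 q u ℕ.+ moment w a′ 0 q (suc u)
      ≡⟨ moment-step w a′ 0 q u ⟨
    moment w a′ 0 (suc q) u ∎

  -- Modulo what is common to a and a′, only the first moment survives;
  -- both sides are moved so that no subtraction occurs.

  moment-top₁ : ∀ {n} → (∀ k → k < n → Balanced k w) → ∀ q u → q ℕ.+ u ≡ n →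
                moment w a 1 q u ℕ.+ moment w a′ 1 0 n ≡ moment w a′ 1 q u ℕ.+ moment w a 1 0 n
  moment-top₁ bal zero u refl = ℕ.+-comm (moment w a 1 0 u) _
  moment-top₁ {n} bal (suc q) u refl = begin
    moment w a 1 (suc q) u ℕ.+ G′
      ≡⟨ cong (ℕ._+ G′) (moment-step w a 1 q u) ⟩
    moment w a 2 q u ℕ.+ moment w a 1 q (suc u) ℕ.+ G′
      ≡⟨ ℕ.+-assoc (moment w a 2 q u) _ _ ⟩
    moment w a 2 q u ℕ.+ (moment w a 1 q (suc u) ℕ.+ G′)
      ≡⟨ cong₂ ℕ._+_ (moment-high bal 2 q u ℕ.≤-refl)
                     (moment-top₁ bal q (suc u) (ℕ.+-suc q u)) ⟩
    moment w a′ 2 q u ℕ.+ (moment w a′ 1 q (suc u) ℕ.+ G)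
      ≡⟨ ℕ.+-assoc (moment w a′ 2 q u) _ _ ⟨
    moment w a′ 2 q u ℕ.+ moment w a′ 1 q (suc u) ℕ.+ G
      ≡⟨ cong (ℕ._+ G) (moment-step w a′ 1 q u) ⟨
    moment w a′ 1 (suc q) u ℕ.+ G ∎
    where
    G  = moment w a 1 0 n
    G′ = moment w a′ 1 0 n

  -- Each of the `q` expansions splits off one first moment, whence the coefficient `q`; at `u = 0`
  -- it is the binomial coefficient C(n+1, 1).
  moment-top₀ : ∀ {n} → (∀ k → k < n → Balanced k w) → ∀ q u → q ℕ.+ u ≡ suc n →
                moment w a 0 q u ℕ.+ q ℕ.* moment w a′ 1 0 n ≡
                moment w a′ 0 q u ℕ.+ q ℕ.* moment w a 1 0 n
  moment-top₀ bal zero    u _ = refl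
  moment-top₀ {n} bal (suc q) u h = begin
    moment w a 0 (suc q) u ℕ.+ (G′ ℕ.+ q ℕ.* G′)
      ≡⟨ cong (ℕ._+ (G′ ℕ.+ q ℕ.* G′)) (moment-step w a 0 q u) ⟩
    moment w a 1 q u ℕ.+ moment w a 0 q (suc u) ℕ.+ (G′ ℕ.+ q ℕ.* G′)
      ≡⟨ exchange (moment w a 1 q u) _ _ _ ⟩
    moment w a 1 q u ℕ.+ G′ ℕ.+ (moment w a 0 q (suc u) ℕ.+ q ℕ.* G′)
      ≡⟨ cong₂ ℕ._+_ (moment-top₁ bal q u (ℕ.suc-injective h))
                     (moment-top₀ bal q (suc u) (trans (ℕ.+-suc q u) h)) ⟩
    moment w a′ 1 q u ℕ.+ G ℕ.+ (moment w a′ 0 q (suc u) ℕ.+ q ℕ.* G)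
      ≡⟨ exchange (moment w a′ 1 q u) _ _ _ ⟨
    moment w a′ 1 q u ℕ.+ moment w a′ 0 q (suc u) ℕ.+ (G ℕ.+ q ℕ.* G)
      ≡⟨ cong (ℕ._+ (G ℕ.+ q ℕ.* G)) (moment-step w a′ 0 q u) ⟨
    moment w a′ 0 (suc q) u ℕ.+ (G ℕ.+ q ℕ.* G) ∎
    where
    G  = moment w a 1 0 n
    G′ = moment w a′ 1 0 n
    exchange : ∀ x y z t → x ℕ.+ y ℕ.+ (z ℕ.+ t) ≡ x ℕ.+ z ℕ.+ (y ℕ.+ t)
    exchange = ℕ-Ring.solve-∀

module _ {b m} (L : LatinSquare b) (w : Word b m) where

  private
    -- By `sum-columnOf` the offsets of any two letters run through the same multiples of `m`.
    module Compare (x y : Fin b) = Comparison w x (offset L w x) (offset L w y)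
      (λ p → trans (sum-columnOf L x (λ k → (m ℕ.* toℕ k) ℕ.^ p))
                   (sym (sum-columnOf L y (λ k → (m ℕ.* toℕ k) ℕ.^ p))))

  apply-balanced : ∀ n → (∀ k → k < n → Balanced k w) → Balanced n (apply L w)
  apply-balanced n bal x y = begin
    powerSum n (apply L w) x         ≡⟨ powerSum-apply L w n x ⟩
    moment w (offset L w x) 0 n 0    ≡⟨ Compare.moment-top x y bal n 0 (ℕ.+-identityʳ n) ⟩
    moment w (offset L w y) 0 n 0    ≡⟨ powerSum-apply L w n y ⟨
    powerSum n (apply L w) y         ∎
    where open ≡-Reasoning

  -- Entry `x` of the vector M S_n, kept in the natural numbers.
  weighted : ℕ → Fin b → ℕ
  weighted n x = sum λ j → suc (toℕ (columnOf L j x)) ℕ.* powerSum n w j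

  private
    moment₁ : ∀ n x → moment w (offset L w x) 1 0 n ≡
                      m ℕ.* sum (λ j → toℕ (columnOf L j x) ℕ.* powerSum n w j)
    moment₁ n x = begin
      moment w (offset L w x) 1 0 n
        ≡⟨ moment-powerSum w (offset L w x) 1 n ⟩
      sum (λ j → offset L w x j ℕ.^ 1 ℕ.* powerSum n w j)
        ≡⟨ sum-cong-≗ (λ j → regroup m (toℕ (columnOf L j x)) (powerSum n w j)) ⟩
      sum (λ j → m ℕ.* (toℕ (columnOf L j x) ℕ.* powerSum n w j))
        ≡⟨ *-distribˡ-sum m (λ j → toℕ (columnOf L j x) ℕ.* powerSum n w j) ⟨
      m ℕ.* sum (λ j → toℕ (columnOf L j x) ℕ.* powerSum n w j) ∎
      where
      open ≡-Reasoning
      regroup : ∀ m c s → m ℕ.* c ℕ.* 1 ℕ.* s ≡ m ℕ.* (c ℕ.* s)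
      regroup = ℕ-Ring.solve-∀

    -- The matrix counts columns from 1 and `offset` counts them from 0; the difference is a total
    -- that does not depend on `x`.
    weighted-moment : ∀ n x → m ℕ.* weighted n x ≡
                      m ℕ.* sum (powerSum n w) ℕ.+ moment w (offset L w x) 1 0 n
    weighted-moment n x = begin
      m ℕ.* weighted n x
        ≡⟨ cong (m ℕ.*_) (∑-distrib-+ (powerSum n w) (λ j → toℕ (columnOf L j x) ℕ.* powerSum n w j)) ⟩
      m ℕ.* (sum (powerSum n w) ℕ.+ sum (λ j → toℕ (columnOf L j x) ℕ.* powerSum n w j))
        ≡⟨ ℕ.*-distribˡ-+ m (sum (powerSum n w)) _ ⟩
      m ℕ.* sum (powerSum n w) ℕ.+ m ℕ.* sum (λ j → toℕ (columnOf L j x) ℕ.* powerSum n w j)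
        ≡⟨ cong (m ℕ.* sum (powerSum n w) ℕ.+_) (moment₁ n x) ⟨
      m ℕ.* sum (powerSum n w) ℕ.+ moment w (offset L w x) 1 0 n ∎
      where open ≡-Reasoning

  apply-balanced⇒weighted : .{{ℕ.NonZero m}} → ∀ n → (∀ k → k < n → Balanced k w) →
    Balanced (suc n) (apply L w) → ∀ x y → weighted n x ≡ weighted n y
  apply-balanced⇒weighted n bal balL x y = ℕ.*-cancelˡ-≡ _ _ m (begin
    m ℕ.* weighted n x                                            ≡⟨ weighted-moment n x ⟩
    m ℕ.* sum (powerSum n w) ℕ.+ moment w (offset L w x) 1 0 n    ≡⟨ cong (m ℕ.* sum (powerSum n w) ℕ.+_) same ⟩
    m ℕ.* sum (powerSum n w) ℕ.+ moment w (offset L w y) 1 0 n    ≡⟨ weighted-moment n y ⟨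
    m ℕ.* weighted n y                                            ∎)
    where
    open ≡-Reasoning
    top : moment w (offset L w x) 0 (suc n) 0 ≡ moment w (offset L w y) 0 (suc n) 0
    top = trans (sym (powerSum-apply L w (suc n) x)) (trans (balL x y) (powerSum-apply L w (suc n) y))
    same : moment w (offset L w x) 1 0 n ≡ moment w (offset L w y) 1 0 n
    -- By `top` the full moments cancel in `moment-top₀`, and then so does the coefficient `suc n`.
    same = sym (ℕ.*-cancelˡ-≡ _ _ (suc n) (ℕ.+-cancelˡ-≡ (moment w (offset L w x) 0 (suc n) 0) _ _
      (trans (Compare.moment-top₀ x y bal (suc n) 0 (ℕ.+-identityʳ (suc n)))
             (cong (ℕ._+ _) (sym top)))))

  weighted⇒apply-balanced : ∀ n → (∀ k → k < n → Balanced k w) →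
    (∀ x y → weighted n x ≡ weighted n y) → Balanced (suc n) (apply L w)
  weighted⇒apply-balanced n bal same x y = begin
    powerSum (suc n) (apply L w) x         ≡⟨ powerSum-apply L w (suc n) x ⟩
    moment w (offset L w x) 0 (suc n) 0    ≡⟨ ℕ.+-cancelʳ-≡ _ _ _ cross ⟩
    moment w (offset L w y) 0 (suc n) 0    ≡⟨ powerSum-apply L w (suc n) y ⟨
    powerSum (suc n) (apply L w) y         ∎
    where
    open ≡-Reasoning
    sameMoment : moment w (offset L w x) 1 0 n ≡ moment w (offset L w y) 1 0 n
    sameMoment = ℕ.+-cancelˡ-≡ (m ℕ.* sum (powerSum n w)) _ _
      (trans (sym (weighted-moment n x))
             (trans (cong (m ℕ.*_) (same x y)) (weighted-moment n y)))
    cross : moment w (offset L w x) 0 (suc n) 0 ℕ.+ suc n ℕ.* moment w (offset L w y) 1 0 n ≡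
            moment w (offset L w y) 0 (suc n) 0 ℕ.+ suc n ℕ.* moment w (offset L w y) 1 0 n
    cross = trans (Compare.moment-top₀ x y bal (suc n) 0 (ℕ.+-identityʳ (suc n)))
                  (cong (λ G → moment w (offset L w y) 0 (suc n) 0 ℕ.+ suc n ℕ.* G) sameMoment)

-- Words with prescribed letter counts

asWord : ∀ {b} (l : List (Fin b)) → Word b (List.length l)
asWord = List.lookup

-- Exponent 0 ignores positions and merely counts occurrences, hence additivity.
count-++ : ∀ {b} (l l′ : List (Fin b)) x →
           powerSum 0 (asWord (l ++ l′)) x ≡ powerSum 0 (asWord l) x ℕ.+ powerSum 0 (asWord l′) x
count-++ []      l′ x = refl
count-++ (y ∷ l) l′ x = trans
  (cong (n ℕ.+_) (count-++ l l′ x))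
  (sym (ℕ.+-assoc n (powerSum 0 (asWord l) x) (powerSum 0 (asWord l′) x)))
  where n = if does (y Fin.≟ x) then 1 else 0

count-replicate : ∀ {b} n (y x : Fin b) →
                  powerSum 0 (asWord (List.replicate n y)) x ≡ (if does (y Fin.≟ x) then n else 0)
count-replicate zero    y x with y Fin.≟ x
... | yes _ = refl
... | no _  = refl
count-replicate (suc n) y x with y Fin.≟ x | count-replicate n y x
... | yes _ | eq = cong suc eq
... | no _  | eq = eq

-- The map `letter` lets the recursion on `n` proceed over a fixed alphabet.
spell : ∀ {b n} → (Fin n → Fin b) → (Fin n → ℕ) → List (Fin b)
spell {n = zero}  letter s = []
spell {n = suc n} letter s =
  List.replicate (s Fin.zero) (letter Fin.zero) ++ spell (letter ∘ Fin.suc) (s ∘ Fin.suc)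

count-spell : ∀ {b n} (letter : Fin n → Fin b) s x →
              powerSum 0 (asWord (spell letter s)) x ≡
              sum (λ i → if does (letter i Fin.≟ x) then s i else 0)
count-spell {n = zero}  letter s x = refl
count-spell {n = suc n} letter s x = trans
  (count-++ (List.replicate (s Fin.zero) (letter Fin.zero)) _ x)
  (cong₂ ℕ._+_ (count-replicate (s Fin.zero) (letter Fin.zero) x)
               (count-spell (letter ∘ Fin.suc) (s ∘ Fin.suc) x))

word-with-counts : ∀ {b} (s : Fin b → ℕ) → ∃ λ m → Σ (Word b m) λ w → ∀ x → powerSum 0 w x ≡ s x
word-with-counts s = _ , asWord (spell (λ j → j) s) , λ x →
  trans (count-spell (λ j → j) s x) (sum-indicator (Fin._≟ x) s x refl (λ _ e → e))

module ∑ℤ where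
  open SemiringSum ℤ.+-*-semiring public
  open FiniteSum ℤ.+-0-monoid public

module ∑ℚ where
  open SemiringSum (CommutativeRing.semiring ℚ.+-*-commutativeRing) public
  open FiniteSum ℚ.+-0-monoid public

-- Kernels of integer matrices

∑ℤ-*-comm : ∀ {n} (f g : Vector ℤ n) → ∑ℤ.sum (λ j → f j ℤ.* g j) ≡ ∑ℤ.sum (λ j → g j ℤ.* f j)
∑ℤ-*-comm f g = ∑ℤ.sum-cong-≗ λ j → ℤ.*-comm (f j) (g j)

-- Kernel vectors are integral, so that they can be turned into letter counts.
NontrivialKernel : ∀ {m n} → (Fin m → Fin n → ℤ) → Set
NontrivialKernel {n = n} A = ∃ λ (v : Vector ℤ n) → (∃ λ j → v j ≢ 0ℤ) × ∀ i → ∑ℤ.sum (λ j → A i j ℤ.* v j) ≡ 0ℤ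

-- Solving a·v = 0 for the k-th unknown, scaled by a k to avoid division.
module Elimination {n} (a : Vector ℤ (suc n)) (k : Fin (suc n)) where

  reduce : Vector ℤ (suc n) → Vector ℤ n
  reduce r j = a k ℤ.* r (punchIn k j) ℤ.- r k ℤ.* a (punchIn k j)

  lift : Vector ℤ n → Vector ℤ (suc n)
  lift v = insertAt (λ j → a k ℤ.* v j) k (ℤ.- ∑ℤ.sum (λ j → a (punchIn k j) ℤ.* v j))

  lift-nonzero : a k ≢ 0ℤ → ∀ v j → v j ≢ 0ℤ → lift v (punchIn k j) ≢ 0ℤ
  lift-nonzero ak≢0 v j vj≢0 lift≡0
    with ℤ.i*j≡0⇒i≡0∨j≡0 (a k) (trans (sym (insertAt-punchIn (λ j → a k ℤ.* v j) k _ j)) lift≡0)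
  ... | inj₁ ak≡0 = ak≢0 ak≡0
  ... | inj₂ vj≡0 = vj≢0 vj≡0

  -- Substituting the solved unknown into the equation `r` amounts to clearing column `k` of `r`
  -- with the pivot row `a`.
  lift-reduce : ∀ r v → ∑ℤ.sum (λ j → r j ℤ.* lift v j) ≡ ∑ℤ.sum (λ j → reduce r j ℤ.* v j)
  lift-reduce r v = begin
    ∑ℤ.sum (λ j → r j ℤ.* lift v j)
      ≡⟨ ∑ℤ.sum-remove {i = k} (λ j → r j ℤ.* lift v j) ⟩
    r k ℤ.* lift v k ℤ.+ ∑ℤ.sum (λ j → r (punchIn k j) ℤ.* lift v (punchIn k j))
      ≡⟨ cong₂ ℤ._+_ (cong (r k ℤ.*_) (insertAt-lookup (λ j → a k ℤ.* v j) k _))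
           (∑ℤ.sum-cong-≗ λ j → cong (r (punchIn k j) ℤ.*_) (insertAt-punchIn (λ j → a k ℤ.* v j) k _ j)) ⟩
    r k ℤ.* (ℤ.- ∑ℤ.sum (λ j → a (punchIn k j) ℤ.* v j)) ℤ.+
      ∑ℤ.sum (λ j → r (punchIn k j) ℤ.* (a k ℤ.* v j))
      ≡⟨ cong (ℤ._+ ∑ℤ.sum (λ j → r (punchIn k j) ℤ.* (a k ℤ.* v j))) (trans (negate (r k) _)
           (∑ℤ.*-distribˡ-sum (ℤ.- r k) (λ j → a (punchIn k j) ℤ.* v j))) ⟩
    ∑ℤ.sum (λ j → (ℤ.- r k) ℤ.* (a (punchIn k j) ℤ.* v j)) ℤ.+
      ∑ℤ.sum (λ j → r (punchIn k j) ℤ.* (a k ℤ.* v j))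
      ≡⟨ ∑ℤ.∑-distrib-+ (λ j → (ℤ.- r k) ℤ.* (a (punchIn k j) ℤ.* v j))
                        (λ j → r (punchIn k j) ℤ.* (a k ℤ.* v j)) ⟨
    ∑ℤ.sum (λ j → (ℤ.- r k) ℤ.* (a (punchIn k j) ℤ.* v j) ℤ.+ r (punchIn k j) ℤ.* (a k ℤ.* v j))
      ≡⟨ ∑ℤ.sum-cong-≗ (λ j → collect (r k) (a (punchIn k j)) (v j) (r (punchIn k j)) (a k)) ⟩
    ∑ℤ.sum (λ j → reduce r j ℤ.* v j) ∎
    where
    open ≡-Reasoning
    negate : ∀ x y → x ℤ.* (ℤ.- y) ≡ (ℤ.- x) ℤ.* y
    negate = ℤ-Ring.solve-∀
    collect : ∀ p q v s t → (ℤ.- p) ℤ.* (q ℤ.* v) ℤ.+ s ℤ.* (t ℤ.* v) ≡ (t ℤ.* s ℤ.- p ℤ.* q) ℤ.* v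
    collect = ℤ-Ring.solve-∀

  reduce-self : ∀ j → reduce a j ≡ 0ℤ
  reduce-self j = ℤ.+-inverseʳ (a k ℤ.* a (punchIn k j))

-- Fraction-free Gaussian elimination: each step removes one equation and one unknown.
underdetermined : ∀ {m} (A : Fin m → Fin (suc m) → ℤ) → NontrivialKernel A
underdetermined {zero}  A = (λ _ → 1ℤ) , (Fin.zero , λ ()) , λ ()
underdetermined {suc m} A with Fin.any? (λ k → ¬? (A Fin.zero k ℤ.≟ 0ℤ))
... | yes (k , pivot) = lift v , (_ , lift-nonzero pivot v _ (proj₂ nonzero)) , kernel
  where
  open Elimination (A Fin.zero) k
  reduced : NontrivialKernel (λ i → reduce (A (Fin.suc i)))
  reduced = underdetermined (λ i → reduce (A (Fin.suc i)))
  v       = proj₁ reduced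
  nonzero = proj₁ (proj₂ reduced)
  kernel : ∀ i → ∑ℤ.sum (λ j → A i j ℤ.* lift v j) ≡ 0ℤ
  kernel Fin.zero    = trans (lift-reduce (A Fin.zero) v)
    (∑ℤ.sum-zero _ λ j → cong (ℤ._* v j) (reduce-self j))
  kernel (Fin.suc i) = trans (lift-reduce (A (Fin.suc i)) v) (proj₂ (proj₂ reduced) i)
-- The first equation is trivial; setting the first unknown to 0 restores the shape required by the
-- induction.
... | no noPivot = v , (_ , proj₂ nonzero) , kernel
  where
  reduced : NontrivialKernel (λ i j → A (Fin.suc i) (Fin.suc j))
  reduced = underdetermined (λ i j → A (Fin.suc i) (Fin.suc j))
  v : Vector ℤ (suc (suc m))
  v = 0ℤ Vector.∷ proj₁ reduced
  nonzero = proj₁ (proj₂ reduced)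
  kernel : ∀ i → ∑ℤ.sum (λ j → A i j ℤ.* v j) ≡ 0ℤ
  kernel Fin.zero    = ∑ℤ.sum-zero (λ j → A Fin.zero j ℤ.* v j) λ j → cong (ℤ._* v j)
    (decidable-stable (A Fin.zero j ℤ.≟ 0ℤ) (λ ≢0 → noPivot (j , ≢0)))
  kernel (Fin.suc i) = trans
    (cong (ℤ._+ ∑ℤ.sum (λ j → A (Fin.suc i) (Fin.suc j) ℤ.* proj₁ reduced j)) (ℤ.*-zeroʳ (A (Fin.suc i) Fin.zero)))
    (trans (ℤ.+-identityˡ _) (proj₂ (proj₂ reduced) i))

-- Integers as rationals

ι : ℤ → ℚ
ι i = i ℚ./ 1

private
  toℚᵘ-ι : ∀ i → ℚ.toℚᵘ (ι i) ℚᵘ.≃ ℚᵘ.mkℚᵘ i 0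
  toℚᵘ-ι i = ℚ.toℚᵘ-fromℚᵘ (ℚᵘ.mkℚᵘ i 0)

ι-injective : ∀ {i j} → ι i ≡ ι j → i ≡ j
ι-injective {i} {j} eq = ℤ.*-cancelʳ-≡ i j 1ℤ (ℚᵘ.drop-*≡* (ℚ.fromℚᵘ-injective {ℚᵘ.mkℚᵘ i 0} {ℚᵘ.mkℚᵘ j 0} eq))

-- Addition in ℚ reduces fractions, so the comparison is made between unnormalised ones, where it is
-- a ring identity in ℤ.
ι-+ : ∀ i j → ι (i ℤ.+ j) ≡ ι i ℚ.+ ι j
ι-+ i j = ℚ.toℚᵘ-injective (begin
  ℚ.toℚᵘ (ι (i ℤ.+ j))                  ≈⟨ toℚᵘ-ι (i ℤ.+ j) ⟩
  ℚᵘ.mkℚᵘ (i ℤ.+ j) 0                   ≈⟨ ℚᵘ.*≡* (same i j) ⟩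
  ℚᵘ.mkℚᵘ i 0 ℚᵘ.+ ℚᵘ.mkℚᵘ j 0          ≈⟨ ℚᵘ.+-cong (toℚᵘ-ι i) (toℚᵘ-ι j) ⟨
  ℚ.toℚᵘ (ι i) ℚᵘ.+ ℚ.toℚᵘ (ι j)        ≈⟨ ℚ.toℚᵘ-homo-+ (ι i) (ι j) ⟨
  ℚ.toℚᵘ (ι i ℚ.+ ι j)                  ∎)
  where
  open import Relation.Binary.Reasoning.Setoid ℚᵘ.≃-setoid
  same : ∀ i j → (i ℤ.+ j) ℤ.* (1ℤ ℤ.* 1ℤ) ≡ (i ℤ.* 1ℤ ℤ.+ j ℤ.* 1ℤ) ℤ.* 1ℤ
  same = ℤ-Ring.solve-∀

ι-* : ∀ i j → ι (i ℤ.* j) ≡ ι i ℚ.* ι j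
ι-* i j = ℚ.toℚᵘ-injective (begin
  ℚ.toℚᵘ (ι (i ℤ.* j))                  ≈⟨ toℚᵘ-ι (i ℤ.* j) ⟩
  ℚᵘ.mkℚᵘ i 0 ℚᵘ.* ℚᵘ.mkℚᵘ j 0          ≈⟨ ℚᵘ.*-cong (toℚᵘ-ι i) (toℚᵘ-ι j) ⟨
  ℚ.toℚᵘ (ι i) ℚᵘ.* ℚ.toℚᵘ (ι j)        ≈⟨ ℚ.toℚᵘ-homo-* (ι i) (ι j) ⟨
  ℚ.toℚᵘ (ι i ℚ.* ι j)                  ∎)
  where open import Relation.Binary.Reasoning.Setoid ℚᵘ.≃-setoid

ι-dot : ∀ {n} (f g : Vector ℤ n) → ι (∑ℤ.sum λ j → f j ℤ.* g j) ≡ ∑ℚ.sum (λ j → ι (f j) ℚ.* ι (g j))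
ι-dot {zero}  f g = refl
ι-dot {suc n} f g = trans (ι-+ (f Fin.zero ℤ.* g Fin.zero) _)
  (cong₂ ℚ._+_ (ι-* (f Fin.zero) (g Fin.zero)) (ι-dot (f ∘ Fin.suc) (g ∘ Fin.suc)))

-- Inverses over ℚ

ℚ-rawRing : RawRing 0ℓ 0ℓ
ℚ-rawRing = CommutativeRing.rawRing ℚ.+-*-commutativeRing

rational : ∀ {b} → Matrix ℤ b → Matrix ℚ b
rational M i j = ι (M i j)

private
  I : ∀ {b} → Matrix ℚ b
  I = idMatrix ℚ-rawRing
  infixl 7 _⊡_
  _⊡_ : ∀ {b} → Matrix ℚ b → Matrix ℚ b → Matrix ℚ b
  _⊡_ = matMul ℚ-rawRing

identityApply : ∀ {b} (v : Vector ℚ b) i → ∑ℚ.sum (λ j → I i j ℚ.* v j) ≡ v i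
identityApply v i = trans
  (∑ℚ.sum-cong-≗ λ j → pull (i Fin.≟ j) (v j))
  (∑ℚ.sum-indicator (i Fin.≟_) v i refl (λ _ → sym))
  where
  pull : ∀ {p} {P : Set p} (P? : Dec P) x → (if does P? then 1ℚ else 0ℚ) ℚ.* x ≡ (if does P? then x else 0ℚ)
  pull (yes _) x = ℚ.*-identityˡ x
  pull (no _)  x = ℚ.*-zeroˡ x

I-sym : ∀ {b} (i j : Fin b) → I i j ≡ I j i
I-sym i j with i Fin.≟ j | j Fin.≟ i
... | yes _ | yes _ = refl
... | no _  | no _  = refl
... | yes p | no q  = contradiction (sym p) q
... | no p  | yes q = contradiction (sym q) p

-- Associativity (u A) v = u (A v), in a form that serves both matrix products and kernel vectors.
dot-assoc : ∀ {m n} (u : Vector ℚ m) (A : Fin m → Fin n → ℚ) (v : Vector ℚ n) →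
            ∑ℚ.sum (λ k → ∑ℚ.sum (λ i → u i ℚ.* A i k) ℚ.* v k) ≡
            ∑ℚ.sum (λ i → u i ℚ.* ∑ℚ.sum (λ k → A i k ℚ.* v k))
dot-assoc {m} {n} u A v = begin
  ∑ℚ.sum (λ k → ∑ℚ.sum (λ i → u i ℚ.* A i k) ℚ.* v k)
    ≡⟨ ∑ℚ.sum-cong-≗ (λ k → ∑ℚ.*-distribʳ-sum (v k) (λ i → u i ℚ.* A i k)) ⟩
  ∑ℚ.sum (λ k → ∑ℚ.sum (λ i → u i ℚ.* A i k ℚ.* v k))
    ≡⟨ ∑ℚ.∑-comm (λ k i → u i ℚ.* A i k ℚ.* v k) ⟩
  ∑ℚ.sum (λ i → ∑ℚ.sum (λ k → u i ℚ.* A i k ℚ.* v k))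
    ≡⟨ ∑ℚ.sum-cong-≗ (λ i → ∑ℚ.sum-cong-≗ λ k → ℚ.*-assoc (u i) (A i k) (v k)) ⟩
  ∑ℚ.sum (λ i → ∑ℚ.sum (λ k → u i ℚ.* (A i k ℚ.* v k)))
    ≡⟨ ∑ℚ.sum-cong-≗ (λ i → ∑ℚ.*-distribˡ-sum (u i) (λ k → A i k ℚ.* v k)) ⟨
  ∑ℚ.sum (λ i → u i ℚ.* ∑ℚ.sum (λ k → A i k ℚ.* v k)) ∎
  where open ≡-Reasoning

-- Take a kernel vector (c , v) of M with column i of I put in front.  If c = 0
-- then v is a kernel vector of M, otherwise -v / c is the required column.
solveColumn : ∀ {b} (M : Matrix ℤ b) i →
  NontrivialKernel M ⊎ ∃ λ (y : Vector ℚ b) → ∀ k → ∑ℚ.sum (λ j → ι (M k j) ℚ.* y j) ≡ I k i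
solveColumn {b} M i = helper (underdetermined augmented)
  where
  δ : Fin b → ℤ
  δ k = if does (k Fin.≟ i) then 1ℤ else 0ℤ
  ι-δ : ∀ k → ι (δ k) ≡ I k i
  ι-δ k with k Fin.≟ i
  ... | yes _ = refl
  ... | no _  = refl
  augmented : Fin b → Fin (suc b) → ℤ
  augmented k = δ k Vector.∷ M k
  helper : NontrivialKernel augmented →
    NontrivialKernel M ⊎ ∃ λ (y : Vector ℚ b) → ∀ k → ∑ℚ.sum (λ j → ι (M k j) ℚ.* y j) ≡ I k i
  helper (v , nonzero , kernel) with v Fin.zero ℤ.≟ 0ℤ
  ... | yes v₀≡0 = inj₁ (v ∘ Fin.suc , tailNonzero nonzero , λ k → trans (sym (dropHead k)) (kernel k))
    where
    tailNonzero : (∃ λ j → v j ≢ 0ℤ) → ∃ λ j → v (Fin.suc j) ≢ 0ℤ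
    tailNonzero (Fin.zero  , v₀≢0) = contradiction v₀≡0 v₀≢0
    tailNonzero (Fin.suc j , vj≢0) = j , vj≢0
    dropHead : ∀ k → δ k ℤ.* v Fin.zero ℤ.+ ∑ℤ.sum (λ j → M k j ℤ.* v (Fin.suc j)) ≡
                     ∑ℤ.sum (λ j → M k j ℤ.* v (Fin.suc j))
    dropHead k = trans (cong (ℤ._+ _) (trans (cong (δ k ℤ.*_) v₀≡0) (ℤ.*-zeroʳ (δ k)))) (ℤ.+-identityˡ _)
  ... | no v₀≢0 = inj₂ (y , solves)
    where
    c = ι (v Fin.zero)
    instance
      c≢0 : ℚ.NonZero c
      c≢0 = ℚ.≢-nonZero λ c≡0 → v₀≢0 (ι-injective c≡0)
    y : Vector ℚ b
    y j = ι (v (Fin.suc j)) ℚ.* (ℚ.- (ℚ.1/ c))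
    open ≡-Reasoning
    open +-*-Solver using (solve; _:+_; _:*_; :-_; _:=_)
    -- Arranged so that c r = 1 and the kernel equation d c + s = 0 can be substituted.
    cancel : ∀ d c s r → s ℚ.* (ℚ.- r) ≡ d ℚ.* (c ℚ.* r) ℚ.+ (d ℚ.* c ℚ.+ s) ℚ.* (ℚ.- r)
    cancel = solve 4 (λ d c s r → s :* (:- r) := d :* (c :* r) :+ (d :* c :+ s) :* (:- r)) refl
    solves : ∀ k → ∑ℚ.sum (λ j → ι (M k j) ℚ.* y j) ≡ I k i
    solves k = begin
      ∑ℚ.sum (λ j → ι (M k j) ℚ.* y j)
        ≡⟨ ∑ℚ.sum-cong-≗ (λ j → ℚ.*-assoc (ι (M k j)) (ι (v (Fin.suc j))) (ℚ.- (ℚ.1/ c))) ⟨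
      ∑ℚ.sum (λ j → ι (M k j) ℚ.* ι (v (Fin.suc j)) ℚ.* (ℚ.- (ℚ.1/ c)))
        ≡⟨ ∑ℚ.*-distribʳ-sum (ℚ.- (ℚ.1/ c)) (λ j → ι (M k j) ℚ.* ι (v (Fin.suc j))) ⟨
      S ℚ.* (ℚ.- (ℚ.1/ c))
        ≡⟨ cancel (ι (δ k)) c S (ℚ.1/ c) ⟩
      ι (δ k) ℚ.* (c ℚ.* ℚ.1/ c) ℚ.+ (ι (δ k) ℚ.* c ℚ.+ S) ℚ.* (ℚ.- (ℚ.1/ c))
        ≡⟨ cong₂ (λ p q → ι (δ k) ℚ.* p ℚ.+ q ℚ.* (ℚ.- (ℚ.1/ c))) (ℚ.*-inverseʳ c)
             (trans (sym (ι-dot (augmented k) v)) (cong ι (kernel k))) ⟩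
      ι (δ k) ℚ.* 1ℚ ℚ.+ 0ℚ ℚ.* (ℚ.- (ℚ.1/ c))
        ≡⟨ cong₂ ℚ._+_ (ℚ.*-identityʳ (ι (δ k))) (ℚ.*-zeroˡ (ℚ.- (ℚ.1/ c))) ⟩
      ι (δ k) ℚ.+ 0ℚ
        ≡⟨ ℚ.+-identityʳ (ι (δ k)) ⟩
      ι (δ k)
        ≡⟨ ι-δ k ⟩
      I k i ∎
      where S = ∑ℚ.sum (λ j → ι (M k j) ℚ.* ι (v (Fin.suc j)))

all-⊎ : ∀ {n p q} {P : Set p} {Q : Fin n → Set q} → (∀ i → P ⊎ Q i) → P ⊎ (∀ i → Q i)
all-⊎ {zero}  f = inj₂ λ ()
all-⊎ {suc n} f with f Fin.zero | all-⊎ (f ∘ Fin.suc)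
... | inj₁ p | _      = inj₁ p
... | inj₂ _ | inj₁ p = inj₁ p
... | inj₂ q | inj₂ g = inj₂ λ { Fin.zero → q ; (Fin.suc i) → g i }

kernel-or-rightInverse : ∀ {b} (M : Matrix ℤ b) →
  NontrivialKernel M ⊎ ∃ λ B → ∀ i j → (rational M ⊡ B) i j ≡ I i j
kernel-or-rightInverse M with all-⊎ (solveColumn M)
... | inj₁ kernel  = inj₁ kernel
... | inj₂ columns = inj₂ ((λ j i → proj₁ (columns i) j) , λ k i → proj₂ (columns i) k)

-- If u M = 0 then u = u (M B) = (u M) B = 0.
rightInverse⇒noLeftKernel : ∀ {b} (M : Matrix ℤ b) B → (∀ i j → (rational M ⊡ B) i j ≡ I i j) →
                            ¬ NontrivialKernel (Vector.transpose M)
rightInverse⇒noLeftKernel M B MB≡I (u , (i , ui≢0) , kernel) = ui≢0 (ι-injective (begin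
  ι (u i)
    ≡⟨ identityApply (ι ∘ u) i ⟨
  ∑ℚ.sum (λ j → I i j ℚ.* ι (u j))
    ≡⟨ ∑ℚ.sum-cong-≗ (λ j → trans (cong (ℚ._* ι (u j)) (trans (I-sym i j) (sym (MB≡I j i)))) (ℚ.*-comm _ (ι (u j)))) ⟩
  ∑ℚ.sum (λ j → ι (u j) ℚ.* (rational M ⊡ B) j i)
    ≡⟨ dot-assoc (ι ∘ u) (rational M) (λ k → B k i) ⟨
  ∑ℚ.sum (λ k → ∑ℚ.sum (λ j → ι (u j) ℚ.* ι (M j k)) ℚ.* B k i)
    ≡⟨ ∑ℚ.sum-zero _ (λ k → trans (cong (ℚ._* B k i) (uM≡0 k)) (ℚ.*-zeroˡ (B k i))) ⟩
  0ℚ ∎))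
  where
  open ≡-Reasoning
  uM≡0 : ∀ k → ∑ℚ.sum (λ j → ι (u j) ℚ.* ι (M j k)) ≡ 0ℚ
  uM≡0 k = trans (sym (ι-dot u (λ j → M j k)))
    (cong ι (trans (∑ℤ-*-comm u (λ j → M j k)) (kernel k)))

-- Elimination on M gives a right inverse B, elimination on the transpose a left inverse C, and B =
-- (C M) B = C (M B) = C.
kernel-or-inverse : ∀ {b} (M : Matrix ℤ b) → NontrivialKernel M ⊎ Invertible ℚ-rawRing (rational M)
kernel-or-inverse M with kernel-or-rightInverse M | kernel-or-rightInverse (Vector.transpose M)
... | inj₁ kernel | _ = inj₁ kernel
... | inj₂ (B , MB≡I) | inj₁ leftKernel =
  contradiction leftKernel (rightInverse⇒noLeftKernel M B MB≡I)
... | inj₂ (B , MB≡I) | inj₂ (Cᵀ , MᵀCᵀ≡I) = inj₂ (B , MB≡I , BM≡I)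
  where
  open ≡-Reasoning
  C = Vector.transpose Cᵀ
  CM≡I : ∀ i j → (C ⊡ rational M) i j ≡ I i j
  CM≡I i j = trans (∑ℚ.sum-cong-≗ λ k → ℚ.*-comm (C i k) (ι (M k j))) (trans (MᵀCᵀ≡I j i) (I-sym j i))
  B≡C : ∀ i j → B i j ≡ C i j
  B≡C i j = begin
    B i j                                          ≡⟨ identityApply (λ k → B k j) i ⟨
    (I ⊡ B) i j                                    ≡⟨ ∑ℚ.sum-cong-≗ (λ k → cong (ℚ._* B k j) (CM≡I i k)) ⟨
    (C ⊡ rational M ⊡ B) i j                       ≡⟨ dot-assoc (C i) (rational M) (λ k → B k j) ⟩
    (C ⊡ (rational M ⊡ B)) i j                     ≡⟨ ∑ℚ.sum-cong-≗ (λ k → cong (C i k ℚ.*_) (trans (MB≡I k j) (I-sym k j))) ⟩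
    ∑ℚ.sum (λ k → C i k ℚ.* I j k)                 ≡⟨ ∑ℚ.sum-cong-≗ (λ k → ℚ.*-comm (C i k) (I j k)) ⟩
    ∑ℚ.sum (λ k → I j k ℚ.* C i k)                 ≡⟨ identityApply (C i) j ⟩
    C i j                                          ∎
  BM≡I : ∀ i j → (B ⊡ rational M) i j ≡ I i j
  BM≡I i j = trans (∑ℚ.sum-cong-≗ λ k → cong (ℚ._* ι (M k j)) (B≡C i k)) (CM≡I i j)

-- Invertibility over ℝ

open RawMonoidDefs (RawRing.+-rawMonoid ℝ-rawRing) using () renaming (sum to sumᴿ)

seq-sum : ∀ {b} (f : Vector ℝ b) n → seq (sumᴿ f) n ≡ ∑ℚ.sum (λ k → seq (f k) n)
seq-sum {zero}  f n = refl
seq-sum {suc b} f n = cong (seq (f Fin.zero) n ℚ.+_) (seq-sum (f ∘ Fin.suc) n)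

seq-idMatrix : ∀ {b} (i j : Fin b) n → seq (idMatrix ℝ-rawRing i j) n ≡ idMatrix ℚ-rawRing i j
seq-idMatrix i j n with i Fin.≟ j
... | yes _ = refl
... | no _  = refl

-- `x ≈ᴿ y` unfolds to this property of the termwise difference.
Null : (ℕ → ℚ) → Set
Null f = ∀ ε → 0ℚ ℚ.< ε → ∃ λ N → ∀ n → N ≤ n → ℚ.∣ f n ∣ ℚ.< ε

null-cong : ∀ {f g} → (∀ n → f n ≡ g n) → Null f → Null g
null-cong f≡g f→0 ε ε>0 with f→0 ε ε>0
... | N , below = N , λ n N≤n → subst (λ p → ℚ.∣ p ∣ ℚ.< ε) (f≡g n) (below n N≤n)

null-zero : ∀ {f} → (∀ n → f n ≡ 0ℚ) → Null f
null-zero f≡0 ε ε>0 = 0 , λ n _ → subst (λ p → ℚ.∣ p ∣ ℚ.< ε) (sym (f≡0 n)) ε>0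

null-+ : ∀ {f g} → Null f → Null g → Null (λ n → f n ℚ.+ g n)
null-+ {f} {g} f→0 g→0 ε ε>0 with f→0 (ℚ.½ ℚ.* ε) half>0 | g→0 (ℚ.½ ℚ.* ε) half>0
  where
  half>0 : 0ℚ ℚ.< ℚ.½ ℚ.* ε
  half>0 = subst (ℚ._< ℚ.½ ℚ.* ε) (ℚ.*-zeroʳ ℚ.½) (ℚ.*-monoʳ-<-pos ℚ.½ ε>0)
... | N₁ , below₁ | N₂ , below₂ = N₁ ℕ.⊔ N₂ , λ n N≤n → begin-strict
  ℚ.∣ f n ℚ.+ g n ∣            ≤⟨ ℚ.∣p+q∣≤∣p∣+∣q∣ (f n) (g n) ⟩
  ℚ.∣ f n ∣ ℚ.+ ℚ.∣ g n ∣      <⟨ ℚ.+-mono-< (below₁ n (ℕ.m⊔n≤o⇒m≤o N₁ N₂ N≤n)) (below₂ n (ℕ.m⊔n≤o⇒n≤o N₁ N₂ N≤n)) ⟩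
  ℚ.½ ℚ.* ε ℚ.+ ℚ.½ ℚ.* ε      ≡⟨ ℚ.*-distribʳ-+ ε ℚ.½ ℚ.½ ⟨
  1ℚ ℚ.* ε                     ≡⟨ ℚ.*-identityˡ ε ⟩
  ε                            ∎
  where open ℚ.≤-Reasoning

null-* : ∀ {f} c → Null f → Null (λ n → f n ℚ.* c)
null-* {f} c f→0 ε ε>0 = proj₁ eventually , λ n N≤n → begin-strict
  ℚ.∣ f n ℚ.* c ∣             ≡⟨ ℚ.∣p*q∣≡∣p∣*∣q∣ (f n) c ⟩
  ℚ.∣ f n ∣ ℚ.* ℚ.∣ c ∣       ≤⟨ ℚ.*-monoˡ-≤-nonNeg ℚ.∣ f n ∣ {{ℚ.nonNegative (ℚ.0≤∣p∣ (f n))}} ∣c∣≤C ⟩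
  ℚ.∣ f n ∣ ℚ.* C             <⟨ ℚ.*-monoˡ-<-pos C (proj₂ eventually n N≤n) ⟩
  ε ℚ.* ℚ.1/ C ℚ.* C          ≡⟨ ℚ.*-assoc ε (ℚ.1/ C) C ⟩
  ε ℚ.* (ℚ.1/ C ℚ.* C)        ≡⟨ cong (ε ℚ.*_) (ℚ.*-inverseˡ C) ⟩
  ε ℚ.* 1ℚ                    ≡⟨ ℚ.*-identityʳ ε ⟩
  ε                           ∎
  where
  open ℚ.≤-Reasoning
  C : ℚ
  -- The added 1 keeps `C` positive when `c` is 0.
  C = ℚ.∣ c ∣ ℚ.+ 1ℚ
  instance
    C⁺ : ℚ.Positive C
    C⁺ = ℚ.positive (ℚ.+-mono-≤-< (ℚ.0≤∣p∣ c) (ℚ.positive⁻¹ 1ℚ))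
    C≢0 : ℚ.NonZero C
    C≢0 = ℚ.pos⇒nonZero C
    C⁻¹⁺ : ℚ.Positive (ℚ.1/ C)
    C⁻¹⁺ = ℚ.1/pos⇒pos C
  ∣c∣≤C : ℚ.∣ c ∣ ℚ.≤ C
  ∣c∣≤C = subst (ℚ._≤ C) (ℚ.+-identityʳ ℚ.∣ c ∣) (ℚ.+-monoʳ-≤ ℚ.∣ c ∣ (ℚ.<⇒≤ (ℚ.positive⁻¹ 1ℚ)))
  eventually : ∃ λ N → ∀ n → N ≤ n → ℚ.∣ f n ∣ ℚ.< ε ℚ.* ℚ.1/ C
  eventually = f→0 (ε ℚ.* ℚ.1/ C)
    (subst (ℚ._< ε ℚ.* ℚ.1/ C) (ℚ.*-zeroˡ (ℚ.1/ C)) (ℚ.*-monoˡ-<-pos (ℚ.1/ C) ε>0))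

null-sum : ∀ {b} (f : Fin b → ℕ → ℚ) → (∀ j → Null (f j)) → Null (λ n → ∑ℚ.sum λ j → f j n)
null-sum {zero}  f f→0 = null-zero λ _ → refl
null-sum {suc b} f f→0 = null-+ (f→0 Fin.zero) (null-sum (f ∘ Fin.suc) (f→0 ∘ Fin.suc))

-- For nonzero `c`, the choice of |c| as tolerance would give |c| < |c|.
null-constant : ∀ c → Null (λ _ → c) → c ≡ 0ℚ
null-constant c c→0 = decidable-stable (c ℚ.≟ 0ℚ) λ c≢0 →
  let ∣c∣>0 = ℚ.≰⇒> λ ∣c∣≤0 → c≢0 (ℚ.∣p∣≡0⇒p≡0 c (ℚ.≤-antisym ∣c∣≤0 (ℚ.0≤∣p∣ c)))
      (N , below) = c→0 ℚ.∣ c ∣ ∣c∣>0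
  in ℚ.<-irrefl refl (below N ℕ.≤-refl)

-- Stated for variable A and A′, since for concrete entries conversion checking
-- unfolds _*ᴿ_ and compares the Cauchy proofs.
seq-matMul : ∀ {b} (A A′ : Matrix ℝ b) i j n →
  seq (matMul ℝ-rawRing A A′ i j) n ≡ ∑ℚ.sum (λ k → seq (A i k) n ℚ.* seq (A′ k j) n)
seq-matMul A A′ i j = seq-sum (λ k → A i k *ᴿ A′ k j)

termwiseInverse : ∀ {b} (A A′ : Matrix ℝ b) →
  (∀ n i j → ∑ℚ.sum (λ k → seq (A i k) n ℚ.* seq (A′ k j) n) ≡ idMatrix ℚ-rawRing i j) →
  ∀ i j → matMul ℝ-rawRing A A′ i j ≈ᴿ idMatrix ℝ-rawRing i j
termwiseInverse A A′ AA′≡I i j = null-zero λ n → trans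
  (cong₂ ℚ._-_ (trans (seq-matMul A A′ i j n) (AA′≡I n i j)) (seq-idMatrix i j n))
  (ℚ.+-inverseʳ (idMatrix ℚ-rawRing i j))

rationalInvertible⇒realInvertible : ∀ {b} (M : Matrix ℤ b) → Invertible ℚ-rawRing (rational M) → RealInvertible M
rationalInvertible⇒realInvertible M (B , MB≡I , BM≡I) =
  (λ i j → fromℚ (B i j)) ,
  termwiseInverse (λ i j → fromℤ (M i j)) (λ i j → fromℚ (B i j)) (λ _ → MB≡I) ,
  termwiseInverse (λ i j → fromℚ (B i j)) (λ i j → fromℤ (M i j)) (λ _ → BM≡I)

-- The alternative in `kernel-or-inverse` turns a bare negation into an explicit vector.
singular⇒kernel : ∀ {b} (M : Matrix ℤ b) → ¬ RealInvertible M → NontrivialKernel M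
singular⇒kernel M singular =
  fromInj₁ (λ inv → contradiction (rationalInvertible⇒realInvertible M inv) singular) (kernel-or-inverse M)

TrivialKernel : ∀ {b} → Matrix ℤ b → Set
TrivialKernel {b} M = ∀ (v : Vector ℤ b) → (∀ i → ∑ℤ.sum (λ j → M i j ℤ.* v j) ≡ 0ℤ) → ∀ i → v i ≡ 0ℤ

-- The residual BM - I of the approximate inverses, applied to a kernel
-- vector v of M, is the constant -v.
realInvertible⇒trivialKernel : ∀ {b} (M : Matrix ℤ b) → RealInvertible M → TrivialKernel M
realInvertible⇒trivialKernel {b} M (B , _ , BM≈I) v Mv≡0 i =
  ι-injective (ℚ.neg-injective (null-constant (ℚ.- ι (v i)) (null-cong residual≡ residual→0)))
  where
  open ≡-Reasoning
  residual : Fin b → ℕ → ℚ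
  residual j n = seq (matMul ℝ-rawRing B (λ i j → fromℤ (M i j)) i j) n ℚ.-
                 seq (idMatrix ℝ-rawRing i j) n
  residual→0 : Null (λ n → ∑ℚ.sum λ j → residual j n ℚ.* ι (v j))
  residual→0 = null-sum (λ j n → residual j n ℚ.* ι (v j)) λ j → null-* (ι (v j)) (BM≈I i j)
  BMv≡0 : ∀ n → ∑ℚ.sum (λ j → ∑ℚ.sum (λ k → seq (B i k) n ℚ.* ι (M k j)) ℚ.* ι (v j)) ≡ 0ℚ
  BMv≡0 n = trans (dot-assoc (λ k → seq (B i k) n) (rational M) (ι ∘ v))
    (∑ℚ.sum-zero _ λ k → trans (cong (seq (B i k) n ℚ.*_) (trans (sym (ι-dot (M k) v)) (cong ι (Mv≡0 k))))
                               (ℚ.*-zeroʳ (seq (B i k) n)))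
  -- The sign is a right factor so that `*-distribʳ-sum` can take it out of the sum.
  split : ∀ p q r → (p ℚ.- q) ℚ.* r ≡ p ℚ.* r ℚ.+ q ℚ.* r ℚ.* (ℚ.- 1ℚ)
  split = solve 3 (λ p q r → (p :- q) :* r := p :* r :+ q :* r :* (:- con 1ℚ)) refl
    where open +-*-Solver using (solve; _:+_; _:*_; :-_; _:-_; _:=_; con)
  residual≡ : ∀ n → ∑ℚ.sum (λ j → residual j n ℚ.* ι (v j)) ≡ ℚ.- ι (v i)
  residual≡ n = begin
    ∑ℚ.sum (λ j → residual j n ℚ.* ι (v j))
      ≡⟨ ∑ℚ.sum-cong-≗ (λ j → cong (ℚ._* ι (v j))
           (cong₂ ℚ._-_ (seq-matMul B (λ i j → fromℤ (M i j)) i j n) (seq-idMatrix i j n))) ⟩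
    ∑ℚ.sum (λ j → (P j ℚ.- I i j) ℚ.* ι (v j))
      ≡⟨ ∑ℚ.sum-cong-≗ (λ j → split (P j) (I i j) (ι (v j))) ⟩
    ∑ℚ.sum (λ j → P j ℚ.* ι (v j) ℚ.+ I i j ℚ.* ι (v j) ℚ.* (ℚ.- 1ℚ))
      ≡⟨ ∑ℚ.∑-distrib-+ (λ j → P j ℚ.* ι (v j)) (λ j → I i j ℚ.* ι (v j) ℚ.* (ℚ.- 1ℚ)) ⟩
    ∑ℚ.sum (λ j → P j ℚ.* ι (v j)) ℚ.+ ∑ℚ.sum (λ j → I i j ℚ.* ι (v j) ℚ.* (ℚ.- 1ℚ))
      ≡⟨ cong₂ ℚ._+_ (BMv≡0 n) (sym (∑ℚ.*-distribʳ-sum (ℚ.- 1ℚ) (λ j → I i j ℚ.* ι (v j)))) ⟩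
    0ℚ ℚ.+ ∑ℚ.sum (λ j → I i j ℚ.* ι (v j)) ℚ.* (ℚ.- 1ℚ)
      ≡⟨ cong (λ p → 0ℚ ℚ.+ p ℚ.* (ℚ.- 1ℚ)) (identityApply (ι ∘ v) i) ⟩
    0ℚ ℚ.+ ι (v i) ℚ.* (ℚ.- 1ℚ)
      ≡⟨ simplify (ι (v i)) ⟩
    ℚ.- ι (v i) ∎
    where
    P = λ j → ∑ℚ.sum (λ k → seq (B i k) n ℚ.* ι (M k j))
    open +-*-Solver using (solve; _:+_; _:*_; :-_; _:=_; con)
    simplify : ∀ p → 0ℚ ℚ.+ p ℚ.* (ℚ.- 1ℚ) ≡ ℚ.- p
    simplify = solve 1 (λ p → con 0ℚ :+ p :* (:- con 1ℚ) := :- p) refl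

-- The encoding matrix

pos-sum : ∀ {n} (f : Fin n → ℕ) → ∑ℤ.sum (λ j → + f j) ≡ + sum f
pos-sum {zero}  f = refl
pos-sum {suc n} f = trans (cong (λ z → + f Fin.zero ℤ.+ z) (pos-sum (f ∘ Fin.suc))) (sym (ℤ.pos-+ (f Fin.zero) _))

module ConstantRowSum {b} (M : Matrix ℤ b) (T : ℤ) .{{_ : ℤ.NonZero T}}
  (rowSum : ∀ x → ∑ℤ.sum (M x) ≡ T) where

  open ≡-Reasoning

  sum-constant : ∀ x c → ∑ℤ.sum (λ j → M x j ℤ.* c) ≡ T ℤ.* c
  sum-constant x c = trans (sym (∑ℤ.*-distribʳ-sum c (M x))) (cong (ℤ._* c) (rowSum x))

  -- Applied with `t = T` in claim (2) and with `t = 1` in claim (3).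
  sum-affine : ∀ x t c (s : Vector ℤ b) →
             ∑ℤ.sum (λ j → M x j ℤ.* (t ℤ.* s j ℤ.+ c)) ≡
             t ℤ.* ∑ℤ.sum (λ j → M x j ℤ.* s j) ℤ.+ T ℤ.* c
  sum-affine x t c s = begin
    ∑ℤ.sum (λ j → M x j ℤ.* (t ℤ.* s j ℤ.+ c))
      ≡⟨ ∑ℤ.sum-cong-≗ (λ j → distribute (M x j) t (s j) c) ⟩
    ∑ℤ.sum (λ j → t ℤ.* (M x j ℤ.* s j) ℤ.+ M x j ℤ.* c)
      ≡⟨ ∑ℤ.∑-distrib-+ (λ j → t ℤ.* (M x j ℤ.* s j)) (λ j → M x j ℤ.* c) ⟩
    ∑ℤ.sum (λ j → t ℤ.* (M x j ℤ.* s j)) ℤ.+ ∑ℤ.sum (λ j → M x j ℤ.* c)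
      ≡⟨ cong₂ ℤ._+_ (sym (∑ℤ.*-distribˡ-sum t (λ j → M x j ℤ.* s j))) (sum-constant x c) ⟩
    t ℤ.* ∑ℤ.sum (λ j → M x j ℤ.* s j) ℤ.+ T ℤ.* c ∎
    where
    distribute : ∀ e t s c → e ℤ.* (t ℤ.* s ℤ.+ c) ≡ t ℤ.* (e ℤ.* s) ℤ.+ e ℤ.* c
    distribute = ℤ-Ring.solve-∀

  -- Constant vectors belong to the eigenvalue `T`, which is nonzero.
  constant⇒zero : ∀ (v : Vector ℤ b) → (∀ i → ∑ℤ.sum (λ j → M i j ℤ.* v j) ≡ 0ℤ) →
    (∀ x y → v x ≡ v y) → ∀ j → v j ≡ 0ℤ
  constant⇒zero v kernel const j = ℤ.*-cancelˡ-≡ T (v j) 0ℤ (begin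
    T ℤ.* v j                         ≡⟨ sum-constant j (v j) ⟨
    ∑ℤ.sum (λ l → M j l ℤ.* v j)      ≡⟨ ∑ℤ.sum-cong-≗ (λ l → cong (M j l ℤ.*_) (const j l)) ⟩
    ∑ℤ.sum (λ l → M j l ℤ.* v l)      ≡⟨ kernel j ⟩
    0ℤ                                ≡⟨ ℤ.*-zeroʳ T ⟨
    T ℤ.* 0ℤ                          ∎)

  -- M 1 = T 1, so M s = c 1 gives M (T s - c 1) = 0.
  trivialKernel⇒constant : TrivialKernel M → ∀ (s : Vector ℤ b) →
    (∀ x y → ∑ℤ.sum (λ j → M x j ℤ.* s j) ≡ ∑ℤ.sum (λ j → M y j ℤ.* s j)) → ∀ x y → s x ≡ s y
  trivialKernel⇒constant trivial s same x y = ℤ.*-cancelˡ-≡ T (s x) (s y)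
    (ℤ-Group.∙-cancelʳ c (T ℤ.* s x) (T ℤ.* s y) (trans (shifted≡0 x) (sym (shifted≡0 y))))
    where
    c : ℤ
    c = ℤ.- ∑ℤ.sum (λ j → M x j ℤ.* s j)
    shifted : Vector ℤ b
    shifted j = T ℤ.* s j ℤ.+ c
    shifted≡0 : ∀ j → shifted j ≡ 0ℤ
    shifted≡0 = trivial shifted λ i → begin
      ∑ℤ.sum (λ j → M i j ℤ.* shifted j)
        ≡⟨ sum-affine i T c s ⟩
      T ℤ.* ∑ℤ.sum (λ j → M i j ℤ.* s j) ℤ.+ T ℤ.* c
        ≡⟨ cong (λ z → T ℤ.* z ℤ.+ T ℤ.* c) (same i x) ⟩
      T ℤ.* ∑ℤ.sum (λ j → M x j ℤ.* s j) ℤ.+ T ℤ.* c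
        ≡⟨ ℤ.*-distribˡ-+ T _ c ⟨
      T ℤ.* (∑ℤ.sum (λ j → M x j ℤ.* s j) ℤ.+ c)
        ≡⟨ cong (T ℤ.*_) (ℤ.+-inverseʳ (∑ℤ.sum (λ j → M x j ℤ.* s j))) ⟩
      T ℤ.* 0ℤ
        ≡⟨ ℤ.*-zeroʳ T ⟩
      0ℤ ∎

-- Regularity and the kernel of the encoding matrix

regular : ∀ {b m} (w : Word b m) {N} → (∀ k → k ≤ N → Balanced k w) → Regular (+ N) w
regular w bal k (ℤ.+≤+ k≤N) = bal k k≤N

balanced : ∀ {b m} (w : Word b m) {N} → Regular (+ N) w → ∀ k → k ≤ N → Balanced k w
balanced w reg k k≤N = reg k (ℤ.+≤+ k≤N)

module Encoding {b} (L : LatinSquare (suc b)) where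

  open ≡-Reasoning

  rowTotal : ℕ
  rowTotal = sum (λ (k : Fin (suc b)) → suc (toℕ k))

  𝓔-rowSum : ∀ x → ∑ℤ.sum (𝓔 L x) ≡ + rowTotal
  𝓔-rowSum x = trans (pos-sum (λ j → suc (toℕ (columnOf L j x)))) (cong +_ (sum-columnOf L x (suc ∘ toℕ)))

  -- The alphabet has `suc b` letters, so `rowTotal` is at least 1 and hence nonzero.
  open ConstantRowSum (𝓔 L) (+ rowTotal) 𝓔-rowSum

  weighted-𝓔 : ∀ {m} (w : Word (suc b) m) n x →
               + weighted L w n x ≡ ∑ℤ.sum (λ j → 𝓔 L x j ℤ.* (+ powerSum n w j))
  weighted-𝓔 w n x = trans (sym (pos-sum (λ j → suc (toℕ (columnOf L j x)) ℕ.* powerSum n w j)))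
    (∑ℤ.sum-cong-≗ λ j → ℤ.pos-* (suc (toℕ (columnOf L j x))) (powerSum n w j))

  -- Induction on `N`: with all lower exponents balanced in `w`, exponent N + 1 of `apply L w` makes
  -- M S_N constant, and the trivial kernel carries this over to S_N.
  apply-balanced⁻¹ : TrivialKernel (𝓔 L) → ∀ {m} .{{_ : ℕ.NonZero m}} (w : Word (suc b) m) N →
    (∀ k → k ≤ N → Balanced k (apply L w)) → ∀ k → k ℕ.< N → Balanced k w
  apply-balanced⁻¹ trivial w (suc N) balL k k<1+N with ℕ.m<1+n⇒m<n∨m≡n k<1+N
  ... | inj₁ k<N  = apply-balanced⁻¹ trivial w N (λ k k≤N → balL k (ℕ.m≤n⇒m≤1+n k≤N)) k k<N
  ... | inj₂ refl = λ x y → ℤ.+-injective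
    (trivialKernel⇒constant trivial (λ j → + powerSum N w j)
      (λ x y → trans (sym (weighted-𝓔 w N x)) (trans (cong +_ (same x y)) (weighted-𝓔 w N y))) x y)
    where
    same = apply-balanced⇒weighted L w N
      (apply-balanced⁻¹ trivial w N (λ k k≤N → balL k (ℕ.m≤n⇒m≤1+n k≤N)))
      (balL (suc N) ℕ.≤-refl)

  -- Shifting a kernel vector v to nonnegative letter counts s = v + K
  -- keeps M s constant.
  kernel⇒word : NontrivialKernel (𝓔 L) → ∃ λ m → 1 ≤ m ×
    Σ (Word (suc b) m) λ w → Regular 1ℤ (apply L w) × ¬ Regular 0ℤ w
  kernel⇒word (v , (i , vi≢0) , kernel) =
    m , nonempty m w unbalanced , w , regular (apply L w) low , λ reg → unbalanced (balanced w reg 0 ℕ.z≤n)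
    where
    -- The sum of all absolute values bounds each of them, so every `v j + K` is nonnegative.
    K : ℤ
    K = + sum (λ l → ℤ.∣ v l ∣)
    word = word-with-counts (λ j → ℤ.∣ v j ℤ.+ K ∣)
    m = proj₁ word
    w : Word (suc b) m
    w = proj₁ (proj₂ word)
    counts = proj₂ (proj₂ word)
    -- The empty word is balanced, all its counts being 0.
    nonempty : ∀ m (w : Word (suc b) m) → ¬ Balanced 0 w → 1 ≤ m
    nonempty zero    w ¬bal = contradiction (λ _ _ → refl) ¬bal
    nonempty (suc m) w ¬bal = ℕ.s≤s ℕ.z≤n
    term≤sum : ∀ {n} (f : Fin n → ℕ) j → f j ≤ sum f
    term≤sum f Fin.zero    = ℕ.m≤m+n (f Fin.zero) _
    term≤sum f (Fin.suc j) = ℕ.m≤n⇒m≤o+n (f Fin.zero) (term≤sum (f ∘ Fin.suc) j)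
    nonneg : ∀ i k → ℤ.∣ i ∣ ≤ k → 0ℤ ℤ.≤ i ℤ.+ (+ k)
    nonneg (+ n)    k _   = ℤ.+≤+ ℕ.z≤n
    nonneg -[1+ n ] k n<k = subst (0ℤ ℤ.≤_) (sym (ℤ.⊖-≥ n<k)) (ℤ.+≤+ ℕ.z≤n)
    counts-ℤ : ∀ j → + powerSum 0 w j ≡ 1ℤ ℤ.* v j ℤ.+ K
    counts-ℤ j = trans (cong +_ (counts j))
      (trans (ℤ.0≤i⇒+∣i∣≡i (nonneg (v j) _ (term≤sum (λ l → ℤ.∣ v l ∣) j)))
             (cong (ℤ._+ K) (sym (ℤ.*-identityˡ (v j)))))
    weighted≡ : ∀ x → + weighted L w 0 x ≡ (+ rowTotal) ℤ.* K
    weighted≡ x = begin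
      + weighted L w 0 x                                           ≡⟨ weighted-𝓔 w 0 x ⟩
      ∑ℤ.sum (λ j → 𝓔 L x j ℤ.* (+ powerSum 0 w j))                ≡⟨ ∑ℤ.sum-cong-≗ (λ j → cong (𝓔 L x j ℤ.*_) (counts-ℤ j)) ⟩
      ∑ℤ.sum (λ j → 𝓔 L x j ℤ.* (1ℤ ℤ.* v j ℤ.+ K))                ≡⟨ sum-affine x 1ℤ K v ⟩
      1ℤ ℤ.* ∑ℤ.sum (λ j → 𝓔 L x j ℤ.* v j) ℤ.+ (+ rowTotal) ℤ.* K     ≡⟨ cong (λ z → 1ℤ ℤ.* z ℤ.+ (+ rowTotal) ℤ.* K) (kernel x) ⟩
      0ℤ ℤ.+ (+ rowTotal) ℤ.* K                                        ≡⟨ ℤ.+-identityˡ ((+ rowTotal) ℤ.* K) ⟩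
      (+ rowTotal) ℤ.* K                                               ∎
    low : ∀ k → k ≤ 1 → Balanced k (apply L w)
    low .0 ℕ.z≤n         = apply-balanced L w 0 λ _ ()
    low .1 (ℕ.s≤s ℕ.z≤n) = weighted⇒apply-balanced L w 0 (λ _ ()) λ x y →
      ℤ.+-injective (trans (weighted≡ x) (sym (weighted≡ y)))
    -- Equal counts would make `v` constant, and a constant kernel vector is zero.
    unbalanced : ¬ Balanced 0 w
    unbalanced bal = vi≢0 (constant⇒zero v kernel (λ x y → ℤ.*-cancelˡ-≡ 1ℤ (v x) (v y)
      (ℤ-Group.∙-cancelʳ K (1ℤ ℤ.* v x) (1ℤ ℤ.* v y)
      (trans (sym (counts-ℤ x)) (trans (cong +_ (bal x y)) (counts-ℤ y))))) i)

-- Passage to integer regularity bounds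

apply-regular : ∀ {b m} (L : LatinSquare b) (w : Word b m) r → -1ℤ ≤ℤ r →
                Regular r w → Regular (r +ℤ 1ℤ) (apply L w)
apply-regular L w (+ n) _ reg = regular (apply L w) λ k k≤1+n → apply-balanced L w k λ l l<k →
  balanced w reg l (ℕ.<⇒≤pred (ℕ.≤-trans l<k (ℕ.≤-trans k≤1+n (ℕ.≤-reflexive (ℕ.+-comm n 1)))))
-- For `r = -1` only exponent 0 is in question: every letter occurs `m` times in `apply L w`.
apply-regular L w -[1+ zero ] _ _ = regular (apply L w) λ { .0 ℕ.z≤n → apply-balanced L w 0 λ _ () }
apply-regular L w -[1+ suc _ ] (ℤ.-≤- ()) _

apply-regular⁻¹ : ∀ {b m} (L : LatinSquare (suc b)) → TrivialKernel (𝓔 L) → .{{_ : ℕ.NonZero m}} →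
                  (w : Word (suc b) m) → ∀ r → Regular (r +ℤ 1ℤ) (apply L w) → Regular r w
apply-regular⁻¹ L trivial w (+ n) reg = regular w λ k k≤n →
  Encoding.apply-balanced⁻¹ L trivial w (n ℕ.+ 1) (balanced (apply L w) reg) k
    (ℕ.≤-trans (ℕ.s≤s k≤n) (ℕ.≤-reflexive (ℕ.+-comm 1 n)))
-- No exponent lies below a negative bound, so regularity is vacuous.
apply-regular⁻¹ L trivial w -[1+ _ ] reg k ()

mainTheorem2 : ∀ (b : ℕ) → 1 ≤ b → (L : LatinSquare b) → Normalized L →
    (∀ (m : ℕ) → 1 ≤ m → (w : Word b m) → (r : ℤ) → -1ℤ ≤ℤ r →
    (Regular r w → Regular (r +ℤ 1ℤ) (apply L w))
    ×
    (RealInvertible (𝓔 L) → Regular (r +ℤ 1ℤ) (apply L w) → Regular r w))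
    ×
    (¬ RealInvertible (𝓔 L) →
    ∃ λ (m′ : ℕ) → 1 ≤ m′ ×
    Σ (Word b m′) λ w′ → Regular 1ℤ (apply L w′) × ¬ Regular 0ℤ w′)
mainTheorem2 (suc b) _ L _ =
  (λ m 1≤m w r -1≤r →
    apply-regular L w r -1≤r ,
    λ inv → apply-regular⁻¹ L (realInvertible⇒trivialKernel (𝓔 L) inv) {{ℕ.>-nonZero 1≤m}} w r) ,
  λ singular → Encoding.kernel⇒word L (singular⇒kernel (𝓔 L) singular)
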